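{- Let $G$ be a graph and let $x,y\in V(G)$ be distinct vertices such that $N[x]\cup N[y]=V(G)$ and $d(x)\ge d(y)$. If $d(x)\ge 4$ or $N(x)\cap N[y]\ne\emptyset$, then $G$ admits an antimagic orientation.
   Context: All graphs are finite and simple; $N(v)$ denotes the set of neighbours of $v$, $N[v]=N(v)\cup\{v\}$, and $d(v)$ the degree of $v$. For a digraph $D$ and an injective map $\tau$ from the arc set $A(D)$ to positive integers, $s_{(D,\tau)}(u)$ is the sum of labels of arcs entering $u$ minus the sum of labels of arcs leaving $u$ ($0$ if $u$ is isolated). If $D$ has $m$ arcs, a bijection $\tau:A(D)\to\{1,\dots,m\}$ is an antimagic labeling if the values $s_{(D,\tau)}(u)$ are pairwise distinct over all vertices. $G$ admits an antimagic orientation if some orientation $D$ of $G$ has an antimagic labeling. -}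

module Defs where

open import Data.Bool.Base using (Bool; false; T)
open import Data.Bool.Properties using (T?)
open import Data.Fin.Base using (Fin; toℕ)
open import Data.Fin.Subset using (Subset; ∣_∣; _∪_; ⁅_⁆)
open import Data.Integer.Base using (ℤ; +_; _-_)
open import Data.Nat.Base using (ℕ; suc)
open import Data.Nat.Properties using (+-0-commutativeMonoid)
open import Data.Product.Base using (Σ-syntax; _×_; _,_; ∃-syntax)
open import Data.Sum.Base using (_⊎_)
open import Data.Vec.Base using (tabulate)
open import Function.Bundles using (_⇔_; _⤖_; Bijection)
open import Function.Definitions using (Injective)
open import Relation.Binary.PropositionalEquality using (_≡_)
open import Relation.Nullary using (¬_; yes; no)

open import Algebra.Properties.CommutativeMonoid.Sum +-0-commutativeMonoid
  using (sum-syntax)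

record Graph (n : ℕ) : Set where
  field
    adj    : Fin n → Fin n → Bool
    sym    : ∀ u v → adj u v ≡ adj v u
    irrefl : ∀ v → adj v v ≡ false

module _ {n : ℕ} (G : Graph n) where
  open Graph G

  N : Fin n → Subset n
  N v = tabulate (adj v)

  -- N[v]
  closedN : Fin n → Subset n
  closedN v = N v ∪ ⁅ v ⁆

  d : Fin n → ℕ
  d v = ∣ N v ∣

-- arc u v is true when there is an arc from u to v.
record Digraph (n : ℕ) : Set where
  field
    arc : Fin n → Fin n → Bool

module _ {n : ℕ} (D : Digraph n) where
  open Digraph D

  -- T b has at most one inhabitant, so each arc occurs exactly once in A.
  A : Set
  A = Σ[ (u , v) ∈ Fin n × Fin n ] T (arc u v)

  arcCount : ℕ
  arcCount = ∑[ u < n ] ∣ tabulate (arc u) ∣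

  -- Extending τ by 0 to non-arcs lets s sum over all vertices.
  labelAt : (A → ℕ) → Fin n → Fin n → ℕ
  labelAt τ u v with T? (arc u v)
  ... | yes a = τ ((u , v) , a)
  ... | no  _ = 0

  s : (A → ℕ) → Fin n → ℤ
  s τ u = + (∑[ v < n ] labelAt τ v u) - + (∑[ v < n ] labelAt τ u v)

  -- i : Fin m stands for the label i + 1 in {1, …, m}.
  label : A ⤖ Fin arcCount → A → ℕ
  label τ a = suc (toℕ (Bijection.to τ a))

  IsAntimagicLabeling : A ⤖ Fin arcCount → Set
  IsAntimagicLabeling τ = Injective _≡_ _≡_ (s (label τ))

record IsOrientation {n : ℕ} (G : Graph n) (D : Digraph n) : Set where
  open Graph G
  open Digraph D
  field
    underlying : ∀ u v → T (adj u v) ⇔ (T (arc u v) ⊎ T (arc v u))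
    asymmetric : ∀ u v → T (arc u v) → ¬ T (arc v u)

AdmitsAntimagicOrientation : {n : ℕ} → Graph n → Set
AdmitsAntimagicOrientation {n} G =
  Σ[ D ∈ Digraph n ] IsOrientation G D × ∃[ τ ] IsAntimagicLabeling D τ

-- Each vertex v outside {x, y} gets one edge from a hub x or y; these edges point away from the hubs and carry
-- the largest labels. The edges between the other vertices get the smallest labels, in an order in which the
-- partial sums satisfy s(v) ≥ -(number of these edges); so, whatever the hub edges are, s(v) > 0 ≥ s(x), s(y).
-- Giving the large labels out in the order of the partial sums makes all s(v) distinct. If s(x) = s(y) happens, a
-- second labeling exists in which the s(v) are still distinct but s(x) - s(y) is different: reverse the edge xy;
-- or exchange the two edges from the hubs to each common neighbour; or, when there are no common neighbours and xy
-- is not an edge, permute the order of the v.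
-- If N(y) ⊆ {x}, or vice versa, only x, or y, is used as a hub.
module Submission where

open import Defs
import Data.Integer.Properties as ℤ
import Data.Nat.Properties as ℕ
open import Algebra.Properties.AbelianGroup ℤ.+-0-abelianGroup using (∙-cancelˡ)
open import Algebra.Properties.CommutativeMonoid.Sum ℕ.+-0-commutativeMonoid using (sum-syntax)
open import Data.Bool.Base using (Bool; true; false; T; not; _∧_; _xor_; if_then_else_)
import Data.Bool.Properties as Bool
open import Data.Bool.Properties using (T?; T-irrelevant; T-≡)
open import Data.Empty using (⊥)
open import Data.Fin.Base using (Fin; zero; suc; toℕ; fromℕ; fromℕ<; inject₁; cast)
import Data.Fin.Properties as Fin
open import Data.Fin.Properties using (_≟_; _<?_; <-cmp; toℕ<n; toℕ-fromℕ; toℕ-fromℕ<; toℕ-inject₁; toℕ-cast; toℕ-injective; fromℕ≢inject₁; inject₁-injective)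
open import Data.Fin.Subset using (_∪_; _∩_; ⁅_⁆; ⊤; Nonempty; ∣_∣) renaming (_∈_ to _∈ₛ_)
open import Data.Fin.Subset.Properties using (x∈p∪q⁻; x∈p∩q⁻; x∈⁅y⁆⇒x≡y; ∈⊤)
open import Data.Integer.Base using (ℤ; _+_; _-_; _*_; -_; _≤_; 0ℤ; 1ℤ; +≤+; nonNegative) renaming (+_ to pos)
open import Data.Integer.Tactic.RingSolver using (solve-∀)
open import Data.List.Base as List using (List; []; _∷_; [_]; _++_; map; length; filterᵇ; allFin; cartesianProduct)
open import Data.List.Membership.Propositional using (_∈_; find)
open import Data.List.Membership.Propositional.Properties using (∈-∃++; ∈-++⁺ʳ; ∈-filter⁺; ∈-filter⁻; ∈-allFin)
open import Data.List.Properties using (map-tabulate; length-++-sucʳ; ++-assoc)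
open import Data.List.Relation.Binary.Permutation.Propositional using (_↭_; refl; prep; swap; trans; ↭-refl; ↭-sym; ↭-trans)
open import Data.List.Relation.Binary.Permutation.Propositional.Properties using (shift; shifts; ++⁺ˡ; ++⁺ʳ; ++-comm; ∈-resp-↭)
open import Data.List.Relation.Unary.All as All using (All; []; _∷_)
import Data.List.Relation.Unary.All.Properties as All
open import Data.List.Relation.Unary.AllPairs as AllPairs using (AllPairs; []; _∷_)
open import Data.List.Relation.Unary.Any as Any using (here; there)
open import Data.List.Relation.Unary.Linked.Properties using (Linked⇒AllPairs)
import Data.List.Sort as Sort
open import Data.Nat.Base as ℕ using (ℕ; suc; z≤n; _≥_)
open import Data.Product.Base using (_×_; _,_; proj₁; proj₂; Σ-syntax; ∃-syntax)
open import Data.Product.Properties using (≡-dec)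
open import Data.Sum.Base as Sum using (_⊎_; inj₁; inj₂; [_,_]′)
open import Data.Vec.Base using (tabulate)
open import Data.Vec.Properties using (lookup∘tabulate; []=⇒lookup)
open import Function.Base using (_∘_)
open import Function.Bundles using (Equivalence; mk⇔; mk⤖; _⤖_)
import Relation.Binary.Construct.On as On
open import Relation.Binary.Definitions using (tri<; tri≈; tri>)
open import Relation.Binary.PropositionalEquality as ≡ using (_≡_; _≢_; refl; sym; cong; cong₂; subst)
open import Relation.Nullary using (¬_; Dec; does; yes; no; contradiction)
open import Relation.Nullary.Decidable using (⌊_⌋; toWitness; fromWitness; toSum; dec-true; dec-false; ¬?; _×-dec_; _⊎-dec_)

-- A labelled orientation is encoded as a list of arcs, the label of an arc being its place counted
-- from the end; concatenating lists stacks ranges of labels. The bound for the inner edges comes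
-- from moving chips. Put one chip on every vertex and let each arc in turn carry a chip from its
-- tail to its head. If this never fails, then at every moment the moves out of v exceed the moves
-- into v by at most one; summing over all moments gives s(v) ≥ -(number of arcs), and a hub edge
-- with a label beyond that number lifts s(v) above 0. The obstacle is the tie s(x) = s(y). If xy is
-- not an edge, s(x) + s(y) is the same in both labelings that are tried, so a tie prescribes s(x),
-- and any change of s(x) destroys it. Without common neighbours such a change must come from the
-- order alone. Exchanging two consecutive vertices served by different hubs fails only if their
-- partial sums differ by exactly 1; longer jumps then help unless the partial sums take just two
-- consecutive values, which is impossible because they add up to 0.

variable
  n : ℕ
  X Y : Set

-- Linear arithmetic over the integers

0≤+ : ∀ {i j} → 0ℤ ≤ i → 0ℤ ≤ j → 0ℤ ≤ i + j
0≤+ = ℤ.+-mono-≤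

0≤* : ∀ {i j} → 0ℤ ≤ i → 0ℤ ≤ j → 0ℤ ≤ i * j
0≤* {pos m} {pos k} _ _ = subst (0ℤ ≤_) (ℤ.pos-* m k) (+≤+ z≤n)

0≤- : ∀ {i j} → i ≤ j → 0ℤ ≤ j - i
0≤- = ℤ.i≤j⇒0≤j-i

0≤1 : 0ℤ ≤ 1ℤ
0≤1 = +≤+ z≤n

1≰0 : ¬ 1ℤ ≤ 0ℤ
1≰0 (+≤+ ())

-- Linear inequalities are proved by exhibiting the difference as a sum of nonnegative terms, where a
-- hypothesis k ≡ l contributes a summand k - l.
opaque
  ≤-from : ∀ {i j} k → 0ℤ ≤ k → j - i ≡ k → i ≤ j
  ≤-from k k≥0 eq = ℤ.0≤i-j⇒j≤i (subst (0ℤ ≤_) (sym eq) k≥0)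

  ≡-by : ∀ {i j k l} → k ≡ l → i - j ≡ k - l → i ≡ j
  ≡-by {i} {j} eq diff = ℤ.i-j≡0⇒i≡j i j (≡.trans diff (ℤ.i≡j⇒i-j≡0 eq))

  ≤-by : ∀ {i j k l m} → 0ℤ ≤ m → k ≡ l → j - i ≡ m + (k - l) → i ≤ j
  ≤-by {m = m} m≥0 eq diff =
    ≤-from m m≥0 (≡.trans diff (≡.trans (cong (m +_) (ℤ.i≡j⇒i-j≡0 eq)) (ℤ.+-identityʳ m)))

  ⊥-by : ∀ {k l m} → 0ℤ ≤ m → k ≡ l → - 1ℤ ≡ m + (k - l) → ⊥
  ⊥-by m≥0 eq diff = 1≰0 (≤-by m≥0 eq diff)

halve : ∀ {i j} → i + i ≡ j + j → i ≡ j
halve {i} {j} eq = ℤ.*-cancelˡ-≡ (1ℤ + 1ℤ) i j (≡.trans (ring i) (≡.trans eq (sym (ring j))))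
  where ring : ∀ i → (1ℤ + 1ℤ) * i ≡ i + i
        ring = solve-∀

⟦_⟧ : Bool → ℤ
⟦ b ⟧ = if b then 1ℤ else 0ℤ

0≤⟦⟧ : ∀ b → 0ℤ ≤ ⟦ b ⟧
0≤⟦⟧ true  = +≤+ z≤n
0≤⟦⟧ false = +≤+ z≤n

⟦⟧≤1 : ∀ b → ⟦ b ⟧ ≤ 1ℤ
⟦⟧≤1 true  = ℤ.≤-refl
⟦⟧≤1 false = +≤+ z≤n

opaque
  δ : Fin n → Fin n → ℤ
  δ u v = ⟦ does (u ≟ v) ⟧

  0≤δ : (u v : Fin n) → 0ℤ ≤ δ u v
  0≤δ u v = 0≤⟦⟧ (does (u ≟ v))

  δ≤1 : (u v : Fin n) → δ u v ≤ 1ℤ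
  δ≤1 u v = ⟦⟧≤1 (does (u ≟ v))

  δ-≡ : {u v : Fin n} → u ≡ v → δ u v ≡ 1ℤ
  δ-≡ {u = u} {v} eq = cong ⟦_⟧ (dec-true (u ≟ v) eq)

  δ-≢ : {u v : Fin n} → u ≢ v → δ u v ≡ 0ℤ
  δ-≢ {u = u} {v} neq = cong ⟦_⟧ (dec-false (u ≟ v) neq)

  δ-suc : (u v : Fin n) → δ (suc u) (suc v) ≡ δ u v
  δ-suc u v = refl

δ≢0⇒≡ : {u v : Fin n} → δ u v ≢ 0ℤ → u ≡ v
δ≢0⇒≡ {u = u} {v} nz with u ≟ v
... | yes u≡v = u≡v
... | no  u≢v = contradiction (δ-≢ u≢v) nz

δ-sym : (u v : Fin n) → δ u v ≡ δ v u
δ-sym u v with u ≟ v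
... | yes u≡v = ≡.trans (δ-≡ u≡v) (sym (δ-≡ (sym u≡v)))
... | no  u≢v = ≡.trans (δ-≢ u≢v) (sym (δ-≢ (λ e → u≢v (sym e))))

-- Sums and label-weighted sums over lists

tot : (X → ℤ) → List X → ℤ
tot φ []       = 0ℤ
tot φ (a ∷ as) = φ a + tot φ as

len : List X → ℤ
len = tot (λ _ → 1ℤ)

-- The last element of a list has label 1, the first one has label len.
wt : (X → ℤ) → List X → ℤ
wt φ []       = 0ℤ
wt φ (a ∷ as) = φ a * len (a ∷ as) + wt φ as

tot-cong : ∀ {φ ψ : X → ℤ} as → All (λ a → φ a ≡ ψ a) as → tot φ as ≡ tot ψ as
tot-cong []       []       = refl
tot-cong (a ∷ as) (e ∷ es) = cong₂ _+_ e (tot-cong as es)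

tot-ext : ∀ {φ ψ : X → ℤ} → (∀ a → φ a ≡ ψ a) → ∀ as → tot φ as ≡ tot ψ as
tot-ext e as = tot-cong as (All.universal e as)

tot-0 : (as : List X) → tot (λ _ → 0ℤ) as ≡ 0ℤ
tot-0 []       = refl
tot-0 (_ ∷ as) = ≡.trans (ℤ.+-identityˡ _) (tot-0 as)

tot-+ : ∀ (φ ψ : X → ℤ) as → tot (λ a → φ a + ψ a) as ≡ tot φ as + tot ψ as
tot-+ φ ψ []       = refl
tot-+ φ ψ (a ∷ as) rewrite tot-+ φ ψ as = ring (φ a) (ψ a) (tot φ as) (tot ψ as)
  where ring : ∀ p q s t → p + q + (s + t) ≡ p + s + (q + t)
        ring = solve-∀

tot-*ʳ : ∀ (φ : X → ℤ) c as → tot (λ a → φ a * c) as ≡ tot φ as * c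
tot-*ʳ φ c []       = sym (ℤ.*-zeroˡ c)
tot-*ʳ φ c (a ∷ as) rewrite tot-*ʳ φ c as = sym (ℤ.*-distribʳ-+ c (φ a) (tot φ as))

tot-neg : ∀ (φ : X → ℤ) as → tot (λ a → - φ a) as ≡ - tot φ as
tot-neg φ []       = refl
tot-neg φ (a ∷ as) rewrite tot-neg φ as = sym (ℤ.neg-distrib-+ (φ a) (tot φ as))

tot-++ : ∀ (φ : X → ℤ) as bs → tot φ (as ++ bs) ≡ tot φ as + tot φ bs
tot-++ φ []       bs = sym (ℤ.+-identityˡ _)
tot-++ φ (a ∷ as) bs rewrite tot-++ φ as bs = sym (ℤ.+-assoc (φ a) (tot φ as) (tot φ bs))

tot-map : ∀ (φ : Y → ℤ) (g : X → Y) as → tot φ (map g as) ≡ tot (λ a → φ (g a)) as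
tot-map φ g []       = refl
tot-map φ g (a ∷ as) = cong (φ (g a) +_) (tot-map φ g as)

tot-swap : ∀ (φ : X → Y → ℤ) as bs →
  tot (λ a → tot (φ a) bs) as ≡ tot (λ b → tot (λ a → φ a b) as) bs
tot-swap φ []       bs = sym (tot-0 bs)
tot-swap φ (a ∷ as) bs rewrite tot-swap φ as bs = sym (tot-+ (φ a) (λ b → tot (λ a → φ a b) as) bs)

tot-filter : ∀ (φ : X → ℤ) (p : X → Bool) as → tot φ (filterᵇ p as) ≡ tot (λ a → ⟦ p a ⟧ * φ a) as
tot-filter φ p []       = refl
tot-filter φ p (a ∷ as) with p a
... | true  = cong₂ _+_ (sym (ℤ.*-identityˡ (φ a))) (tot-filter φ p as)
... | false = ≡.trans (tot-filter φ p as) (sym (ℤ.+-identityˡ _))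

tot-× : ∀ (φ : X × Y → ℤ) as bs → tot φ (cartesianProduct as bs) ≡ tot (λ a → tot (λ b → φ (a , b)) bs) as
tot-× φ []       bs = refl
tot-× φ (a ∷ as) bs = ≡.trans (tot-++ φ (map (a ,_) bs) (cartesianProduct as bs))
  (cong₂ _+_ (tot-map φ (a ,_) bs) (tot-× φ as bs))

tot-↭ : ∀ (φ : X → ℤ) {as bs} → as ↭ bs → tot φ as ≡ tot φ bs
tot-↭ φ refl        = refl
tot-↭ φ (prep a p)  = cong (φ a +_) (tot-↭ φ p)
tot-↭ φ (swap {as} {bs} a b p) rewrite tot-↭ φ p = ring (φ a) (φ b) (tot φ bs)
  where ring : ∀ p q s → p + (q + s) ≡ q + (p + s)
        ring = solve-∀
tot-↭ φ (trans p q) = ≡.trans (tot-↭ φ p) (tot-↭ φ q)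

0≤tot : ∀ {φ : X → ℤ} → (∀ a → 0ℤ ≤ φ a) → ∀ as → 0ℤ ≤ tot φ as
0≤tot φ≥0 []       = ℤ.≤-refl
0≤tot φ≥0 (a ∷ as) = 0≤+ (φ≥0 a) (0≤tot φ≥0 as)

0≤len : (as : List X) → 0ℤ ≤ len as
0≤len = 0≤tot (λ _ → +≤+ z≤n)

≤tot : ∀ {φ : X → ℤ} → (∀ a → 0ℤ ≤ φ a) → ∀ {a as} → a ∈ as → φ a ≤ tot φ as
≤tot {φ = φ} φ≥0 {as = _ ∷ as} (here {a} refl) =
  ≤-from (tot φ as) (0≤tot φ≥0 as) (ring (φ a) (tot φ as))
  where ring : ∀ p q → p + q - p ≡ q
        ring = solve-∀
≤tot {φ = φ} φ≥0 {a} {as = b ∷ as} (there a∈as) =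
  ≤-from _ (0≤+ (φ≥0 b) (0≤- (≤tot φ≥0 a∈as))) (ring (φ b) (tot φ as) (φ a))
  where ring : ∀ p q r → p + q - r ≡ p + (q - r)
        ring = solve-∀

tot≢0⇒∃ : ∀ {φ : X → ℤ} as → tot φ as ≢ 0ℤ → ∃[ a ] a ∈ as × φ a ≢ 0ℤ
tot≢0⇒∃ []       nz = contradiction refl nz
tot≢0⇒∃ {φ = φ} (a ∷ as) nz with φ a ℤ.≟ 0ℤ
... | no  φa≢0 = a , here refl , φa≢0
... | yes φa≡0 with b , b∈as , φb≢0 ← tot≢0⇒∃ as (λ z → nz (cong₂ _+_ φa≡0 z)) = b , there b∈as , φb≢0

tot≡0⇒All : ∀ {φ : X → ℤ} → (∀ a → 0ℤ ≤ φ a) → ∀ as → tot φ as ≡ 0ℤ → All (λ a → φ a ≡ 0ℤ) as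
tot≡0⇒All φ≥0 as z = Data.List.Relation.Unary.All.tabulate
  (λ a∈as → ℤ.≤-antisym (subst (_ ≤_) z (≤tot φ≥0 a∈as)) (φ≥0 _))
  where import Data.List.Relation.Unary.All

wt-cong : ∀ {φ ψ : X → ℤ} as → All (λ a → φ a ≡ ψ a) as → wt φ as ≡ wt ψ as
wt-cong []       []       = refl
wt-cong (a ∷ as) (e ∷ es) = cong₂ _+_ (cong (_* _) e) (wt-cong as es)

wt-ext : ∀ {φ ψ : X → ℤ} → (∀ a → φ a ≡ ψ a) → ∀ as → wt φ as ≡ wt ψ as
wt-ext e as = wt-cong as (All.universal e as)

wt-0 : (as : List X) → wt (λ _ → 0ℤ) as ≡ 0ℤ
wt-0 []       = refl
wt-0 (_ ∷ as) = ≡.trans (ℤ.+-identityˡ _) (wt-0 as)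

wt-zero : ∀ {φ : X → ℤ} as → All (λ a → φ a ≡ 0ℤ) as → wt φ as ≡ 0ℤ
wt-zero as z = ≡.trans (wt-cong as z) (wt-0 as)

wt-+ : ∀ (φ ψ : X → ℤ) as → wt (λ a → φ a + ψ a) as ≡ wt φ as + wt ψ as
wt-+ φ ψ []       = refl
wt-+ φ ψ (a ∷ as) rewrite wt-+ φ ψ as = ring (φ a) (ψ a) (len (a ∷ as)) (wt φ as) (wt ψ as)
  where ring : ∀ p q l s t → (p + q) * l + (s + t) ≡ p * l + s + (q * l + t)
        ring = solve-∀

wt-neg : ∀ (φ : X → ℤ) as → wt (λ a → - φ a) as ≡ - wt φ as
wt-neg φ []       = refl
wt-neg φ (a ∷ as) rewrite wt-neg φ as = ring (φ a) (len (a ∷ as)) (wt φ as)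
  where ring : ∀ p l s → - p * l + - s ≡ - (p * l + s)
        ring = solve-∀

-- Labels count from the end, so putting `bs` behind `as` raises every label of `as` by `len bs` and
-- leaves those of `bs` alone.
wt-++ : ∀ (φ : X → ℤ) as bs → wt φ (as ++ bs) ≡ wt φ as + len bs * tot φ as + wt φ bs
wt-++ φ []       bs = ring (len bs) (wt φ bs)
  where ring : ∀ l s → s ≡ 0ℤ + l * 0ℤ + s
        ring = solve-∀
wt-++ φ (a ∷ as) bs rewrite wt-++ φ as bs | tot-++ (λ _ → 1ℤ) as bs =
  ring (φ a) (len as) (len bs) (wt φ as) (tot φ as) (wt φ bs)
  where ring : ∀ p k l s t w → p * (1ℤ + (k + l)) + (s + l * t + w) ≡ p * (1ℤ + k) + s + l * (p + t) + w
        ring = solve-∀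

wt-map : ∀ (φ : Y → ℤ) (g : X → Y) as → wt φ (map g as) ≡ wt (λ a → φ (g a)) as
wt-map φ g []       = refl
wt-map φ g (a ∷ as) rewrite wt-map φ g as | tot-map (λ _ → 1ℤ) g as = refl

wt-swap : ∀ (φ : X → Y → ℤ) as bs →
  tot (λ a → wt (φ a) bs) as ≡ wt (λ b → tot (λ a → φ a b) as) bs
wt-swap φ as []       = tot-0 as
wt-swap φ as (b ∷ bs) =
  ≡.trans (tot-+ (λ a → φ a b * len (b ∷ bs)) (λ a → wt (φ a) bs) as)
    (cong₂ _+_ (tot-*ʳ (λ a → φ a b) (len (b ∷ bs)) as) (wt-swap φ as bs))

-- Every label is at least 1.
tot≤wt : ∀ {φ : X → ℤ} → (∀ a → 0ℤ ≤ φ a) → ∀ as → tot φ as ≤ wt φ as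
tot≤wt φ≥0 []       = ℤ.≤-refl
tot≤wt {φ = φ} φ≥0 (a ∷ as) =
  ≤-from _ (0≤+ (0≤* (φ≥0 a) (0≤len as)) (0≤- (tot≤wt φ≥0 as))) (ring (φ a) (len as) (wt φ as) (tot φ as))
  where ring : ∀ p l w t → p * (1ℤ + l) + w - (p + t) ≡ p * l + (w - t)
        ring = solve-∀

0≤wt : ∀ {φ : X → ℤ} → (∀ a → 0ℤ ≤ φ a) → ∀ as → 0ℤ ≤ wt φ as
0≤wt φ≥0 as = ℤ.≤-trans (0≤tot φ≥0 as) (tot≤wt φ≥0 as)

tot-tabulate : ∀ {m} (φ : X → ℤ) (g : Fin m → X) → tot φ (List.tabulate g) ≡ tot (λ i → φ (g i)) (allFin m)
tot-tabulate φ g = ≡.trans (cong (tot φ) (sym (map-tabulate (λ i → i) g))) (tot-map φ g (allFin _))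

tot-δ-allFin : (c : Fin n → ℤ) (v : Fin n) → tot (λ u → c u * δ u v) (allFin n) ≡ c v
tot-δ-allFin {n = suc n} c zero
  rewrite tot-tabulate (λ u → c u * δ u zero) (suc {n}) =
  ≡.trans (cong₂ _+_ (cong (c zero *_) (δ-≡ refl))
    (≡.trans (tot-ext (λ u → ≡.trans (cong (c (suc u) *_) (δ-≢ λ ())) (ℤ.*-zeroʳ (c (suc u)))) (allFin n))
      (tot-0 (allFin n))))
  (ring (c zero))
  where ring : ∀ p → p * 1ℤ + 0ℤ ≡ p
        ring = solve-∀
tot-δ-allFin {n = suc n} c (suc v)
  rewrite tot-tabulate (λ u → c u * δ u (suc v)) (suc {n}) =
  ≡.trans (cong₂ _+_ (cong (c zero *_) (δ-≢ λ ()))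
    (≡.trans (tot-ext (λ u → cong (c (suc u) *_) (δ-suc u v)) (allFin n))
             (tot-δ-allFin (λ u → c (suc u)) v)))
  (ring (c zero) (c (suc v)))
  where ring : ∀ p q → p * 0ℤ + q ≡ q
        ring = solve-∀

-- Ordering the edges of a graph

Arc : ℕ → Set
Arc n = Fin n × Fin n

Δ : Fin n → Arc n → ℤ
Δ v (a , b) = δ b v - δ a v

-- This is s(v) for the labeling that the list encodes; `s≡net` makes the link.
net : List (Arc n) → Fin n → ℤ
net L v = wt (Δ v) L

opaque
  -- The indicator of the arc from `u` to `v`. As an integer-valued function it turns membership and
  -- multiplicity in a list into values of `tot`.
  κ : Fin n → Fin n → Arc n → ℤ
  κ u v (a , b) = δ a u * δ b v

  0≤κ : ∀ (u v : Fin n) e → 0ℤ ≤ κ u v e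
  0≤κ u v (a , b) = 0≤* (0≤δ a u) (0≤δ b v)

  κ-refl : (u v : Fin n) → κ u v (u , v) ≡ 1ℤ
  κ-refl u v = cong₂ _*_ (δ-≡ {u = u} refl) (δ-≡ {u = v} refl)

  κ≢0⇒≡ : ∀ {u v : Fin n} {e} → κ u v e ≢ 0ℤ → e ≡ (u , v)
  κ≢0⇒≡ {u = u} {v} {a , b} nz = cong₂ _,_
    (δ≢0⇒≡ (λ z → nz (≡.trans (cong (_* δ b v) z) (ℤ.*-zeroˡ (δ b v)))))
    (δ≢0⇒≡ (λ z → nz (≡.trans (cong (δ a u *_) z) (ℤ.*-zeroʳ (δ a u)))))

  κ-def : ∀ (u v : Fin n) a b → κ u v (a , b) ≡ δ a u * δ b v
  κ-def u v a b = refl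

  -- The indicator of the undirected edge uv; for `u = v` a loop counts twice.
  σ : Fin n → Fin n → Arc n → ℤ
  σ u v e = κ u v e + κ v u e

  0≤σ : ∀ (u v : Fin n) e → 0ℤ ≤ σ u v e
  0≤σ u v e = 0≤+ (0≤κ u v e) (0≤κ v u e)

  σ-def : ∀ (u v : Fin n) a b → σ u v (a , b) ≡ δ a u * δ b v + δ a v * δ b u
  σ-def u v a b = refl

  σ-flip : ∀ (u v : Fin n) a b → σ u v (a , b) ≡ σ u v (b , a)
  σ-flip u v a b = ring (δ a u) (δ b v) (δ a v) (δ b u)
    where ring : ∀ p q r s → p * q + r * s ≡ s * r + q * p
          ring = solve-∀

  σ-refl : (u v : Fin n) → 1ℤ ≤ σ u v (u , v)
  σ-refl u v = ≤-from _ (0≤κ v u (u , v))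
    (≡.trans (cong (λ t → t + κ v u (u , v) - 1ℤ) (κ-refl u v)) (ring (κ v u (u , v))))
    where ring : ∀ p → 1ℤ + p - 1ℤ ≡ p
          ring = solve-∀

  σ≢0⇒≡ : ∀ {u v : Fin n} {e} → σ u v e ≢ 0ℤ → e ≡ (u , v) ⊎ e ≡ (v , u)
  σ≢0⇒≡ {u = u} {v} {e} nz with κ u v e ℤ.≟ 0ℤ
  ... | no  nz′ = inj₁ (κ≢0⇒≡ nz′)
  ... | yes z   = inj₂ (κ≢0⇒≡ λ z′ → nz (cong₂ _+_ z z′))

  tot-σ : ∀ (u v : Fin n) L → tot (σ u v) L ≡ tot (κ u v) L + tot (κ v u) L
  tot-σ u v L = tot-+ (κ u v) (κ v u) L

1≤⇒≢0 : ∀ {i} → 1ℤ ≤ i → i ≢ 0ℤ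
1≤⇒≢0 1≤i refl = 1≰0 1≤i

∈⇒σ≢0 : ∀ {u v : Fin n} {L} → (u , v) ∈ L → tot (σ u v) L ≢ 0ℤ
∈⇒σ≢0 {u = u} {v} uv∈L = 1≤⇒≢0 (ℤ.≤-trans (σ-refl u v) (≤tot (0≤σ u v) uv∈L))

-- Chips p L: starting from p v chips on every vertex v, one chip can be moved along each arc of L in turn.
data Chips {n} (p : Fin n → ℤ) : List (Arc n) → Set where
  []  : Chips p []
  _∷_ : ∀ {e L} → (∀ v → δ (proj₁ e) v ≤ p v) → Chips (λ v → p v + Δ v e) L → Chips p (e ∷ L)

after-move : ∀ {p : Fin n → ℤ} {a} b → (∀ v → δ a v ≤ p v) → ∀ v → δ b v ≤ p v + Δ v (a , b)
after-move {p = p} {a} b a≤p v = ≤-from _ (0≤- (a≤p v)) (ring (δ a v) (δ b v) (p v))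
  where ring : ∀ a b p → p + (b - a) - b ≡ p - a
        ring = solve-∀

-- A vertex that is the tail of no remaining arc can only gain chips, so nonnegativity is enough
-- there.
Chips-weaken : ∀ {p q : Fin n → ℤ} {L} → Chips p L →
  (∀ v → p v ≤ q v ⊎ (0ℤ ≤ q v × All (λ e → proj₁ e ≢ v) L)) → Chips q L
Chips-weaken []      p≤q = []
Chips-weaken {p = p} {q} {e@(a , b) ∷ L} (a≤p ∷ ch) p≤q = a≤q ∷ Chips-weaken ch moved
  where
  a≤q : ∀ v → δ a v ≤ q v
  a≤q v with p≤q v
  ... | inj₁ pv≤qv             = ℤ.≤-trans (a≤p v) pv≤qv
  ... | inj₂ (0≤qv , a≢v ∷ _) = subst (_≤ q v) (sym (δ-≢ a≢v)) 0≤qv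
  moved : ∀ v → p v + Δ v e ≤ q v + Δ v e ⊎ (0ℤ ≤ q v + Δ v e × All (λ e → proj₁ e ≢ v) L)
  moved v with p≤q v
  ... | inj₁ pv≤qv       = inj₁ (ℤ.+-monoˡ-≤ (Δ v e) pv≤qv)
  ... | inj₂ (_ , _ ∷ L≢v) = inj₂ (ℤ.≤-trans (0≤δ b v) (after-move b a≤q v) , L≢v)

-- The chip that travelled from `a` to `b` now stops at `c` on the way; after both moves the chips
-- lie as before.
Chips-expand : ∀ {p : Fin n → ℤ} L₁ {L₂ a b} c →
  Chips p (L₁ ++ (a , b) ∷ L₂) → Chips p (L₁ ++ (a , c) ∷ (c , b) ∷ L₂)
Chips-expand (_ ∷ L₁) c (a≤p ∷ ch) = a≤p ∷ Chips-expand L₁ c ch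
Chips-expand {p = p} [] {a = a} {b} c (a≤p ∷ ch) = a≤p ∷ after-move c a≤p ∷
  Chips-weaken ch (λ v → inj₁ (ℤ.≤-reflexive (ring (p v) (δ a v) (δ b v) (δ c v))))
  where ring : ∀ p a b c → p + (b - a) ≡ p + (c - a) + (b - c)
        ring = solve-∀

-- By Abel summation net L v is the sum, over the nonempty prefixes of L, of (arcs into v) - (arcs out of v), and
-- each of these differences is at least - p v.
Chips⇒net-bound : ∀ {p : Fin n → ℤ} {L} → Chips p L → ∀ v → 0ℤ ≤ net L v + len L * p v
Chips⇒net-bound []                  v = ℤ.≤-refl
Chips⇒net-bound {p = p} {e@(a , b) ∷ L} (a≤p ∷ ch) v = subst (0ℤ ≤_)
  (ring (p v) (Δ v e) (len L) (net L v))
  (0≤+ (Chips⇒net-bound ch v) (ℤ.≤-trans (0≤δ b v) (after-move b a≤p v)))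
  where ring : ∀ p d l w → w + l * (p + d) + (p + d) ≡ d * (1ℤ + l) + w + (1ℤ + l) * p
        ring = solve-∀

SameEdges : List (Arc n) → List (Arc n) → Set
SameEdges L E = ∀ u v → tot (σ u v) L ≡ tot (σ u v) E

cancel-edge : ∀ u v e (L₁ L₂ : List (Arc n)) {f R} → σ u v e ≡ σ u v f →
  tot (σ u v) (L₁ ++ e ∷ L₂) ≡ tot (σ u v) (f ∷ R) → tot (σ u v) (L₁ ++ L₂) ≡ tot (σ u v) R
cancel-edge u v e L₁ L₂ {f} {R} e≡f same = ∙-cancelˡ (σ u v e) (tot (σ u v) (L₁ ++ L₂)) (tot (σ u v) R)
  (≡.trans (sym (tot-↭ (σ u v) (shift e L₁ L₂))) (≡.trans same (cong (_+ tot (σ u v) R) (sym e≡f))))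

-- `L` may traverse the edge ab in either direction, hence the two cases; the detour through `c`
-- follows that direction.
split-edge : ∀ {L : List (Arc n)} {p} a b c R → Chips p L → SameEdges L ((a , b) ∷ R) →
  ∃[ L′ ] Chips p L′ × SameEdges L′ ((a , c) ∷ (c , b) ∷ R)
split-edge {L = L} a b c R ch same
  with e , e∈L , σe≢0 ← tot≢0⇒∃ L (λ z → ∈⇒σ≢0 {L = (a , b) ∷ R} (here refl) (≡.trans (sym (same a b)) z))
  with L₁ , L₂ , refl ← ∈-∃++ e∈L
  with σ≢0⇒≡ {u = a} {b} {e} σe≢0
... | inj₁ refl = L₁ ++ (a , c) ∷ (c , b) ∷ L₂ , Chips-expand L₁ c ch , λ u v →
  ≡.trans (tot-↭ (σ u v) (shifts L₁ ((a , c) ∷ (c , b) ∷ [])))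
    (cong (λ r → σ u v (a , c) + (σ u v (c , b) + r)) (cancel-edge u v (a , b) L₁ L₂ {R = R} refl (same u v)))
... | inj₂ refl = L₁ ++ (b , c) ∷ (c , a) ∷ L₂ , Chips-expand L₁ c ch , λ u v →
  ≡.trans (tot-↭ (σ u v) (shifts L₁ ((b , c) ∷ (c , a) ∷ [])))
  (≡.trans (cong₂ (λ p q → p + (q + tot (σ u v) (L₁ ++ L₂))) (σ-flip u v b c) (σ-flip u v c a))
    (ring (σ u v (c , b)) (σ u v (a , c)) _ _ (cancel-edge u v (b , a) L₁ L₂ {R = R} (σ-flip u v b a) (same u v))))
  where
  ring : ∀ p q r r′ → r ≡ r′ → p + (q + r) ≡ q + (p + r′)
  ring p q r _ refl = ring′ p q r
    where ring′ : ∀ p q r → p + (q + r) ≡ q + (p + r)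
          ring′ = solve-∀

-- If some other edge touches u, the two edges are replaced by one joining their far ends (a trail through u);
-- otherwise the chip on u is never needed again, so uv can be traversed first.
chip-order : ∀ m (E : List (Arc n)) → length E ≡ m → ∃[ L ] Chips (λ _ → 1ℤ) L × SameEdges L E
chip-order m       []             _  = [] , [] , λ _ _ → refl
chip-order (suc m) ((u , v) ∷ E) eq with Any.any? (λ e → (proj₁ e ≟ u) ⊎-dec (proj₂ e ≟ u)) E
... | yes touched with (a , b) , ab∈E , a≡u⊎b≡u ← find touched with E₁ , E₂ , refl ← ∈-∃++ ab∈E = merge a≡u⊎b≡u
  where
  shorter : ∀ w → length ((v , w) ∷ E₁ ++ E₂) ≡ m
  shorter w = ≡.trans (sym (length-++-sucʳ E₁ (a , b) E₂)) (ℕ.suc-injective eq)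
  regroup : ∀ x y {z} → z ≡ σ x y (a , b) →
    σ x y (v , u) + (z + tot (σ x y) (E₁ ++ E₂)) ≡ σ x y (u , v) + tot (σ x y) (E₁ ++ (a , b) ∷ E₂)
  regroup x y refl = cong₂ _+_ (σ-flip x y v u) (tot-↭ (σ x y) (↭-sym (shift (a , b) E₁ E₂)))
  -- The edge joining the far ends may be a loop or parallel to another edge, which is why the
  -- induction runs over arbitrary lists of arcs and not over simple graphs.
  merge : a ≡ u ⊎ b ≡ u → ∃[ L ] Chips (λ _ → 1ℤ) L × SameEdges L ((u , v) ∷ E₁ ++ (a , b) ∷ E₂)
  merge (inj₁ refl)
    with L , ch , same ← chip-order m ((v , b) ∷ E₁ ++ E₂) (shorter b)
    with L′ , ch′ , same′ ← split-edge v b u (E₁ ++ E₂) ch same =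
    L′ , ch′ , λ x y → ≡.trans (same′ x y) (regroup x y refl)
  merge (inj₂ refl)
    with L , ch , same ← chip-order m ((v , a) ∷ E₁ ++ E₂) (shorter a)
    with L′ , ch′ , same′ ← split-edge v a u (E₁ ++ E₂) ch same =
    L′ , ch′ , λ x y → ≡.trans (same′ x y) (regroup x y (σ-flip x y u a))
... | no untouched
  with L , ch , same ← chip-order m E (ℕ.suc-injective eq) =
  (u , v) ∷ L , δ≤1 u ∷ Chips-weaken ch dominated , λ x y → cong (σ x y (u , v) +_) (same x y)
  where
  untouched⇒σ≡0 : ∀ w {e} → ¬ (proj₁ e ≡ u ⊎ proj₂ e ≡ u) → σ u w e ≡ 0ℤ
  untouched⇒σ≡0 w {a , b} ¬touch = ≡.trans (σ-def u w a b)
    (≡.trans (cong₂ (λ p q → p * δ b w + δ a w * q) (δ-≢ (¬touch ∘ inj₁)) (δ-≢ (¬touch ∘ inj₂)))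
      (ring (δ b w) (δ a w)))
    where ring : ∀ p q → 0ℤ * p + q * 0ℤ ≡ 0ℤ
          ring = solve-∀
  -- `L` has the same undirected edges as `E`, so no arc of `L` touches `u`, whatever directions the
  -- induction chose.
  no-tail : All (λ e → proj₁ e ≢ u) L
  no-tail = All.tabulate λ { {a , b} e∈L refl → contradiction
    (≡.trans (same u b)
      (≡.trans (tot-cong E (All.map (untouched⇒σ≡0 b) (All.¬Any⇒All¬ E untouched))) (tot-0 E))) (∈⇒σ≢0 e∈L) }
  dominated : ∀ w → 1ℤ ≤ 1ℤ + Δ w (u , v) ⊎ (0ℤ ≤ 1ℤ + Δ w (u , v) × All (λ e → proj₁ e ≢ w) L)
  dominated w with u ≟ w
  ... | yes refl = inj₂ (≤-from _ (0≤+ (0≤- (δ≤1 u w)) (0≤δ v w)) (ring (δ v w) (δ u w)) , no-tail)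
    where ring : ∀ x y → 1ℤ + (x - y) - 0ℤ ≡ 1ℤ - y + x
          ring = solve-∀
  ... | no  u≢w  = inj₁ (≤-from _ (0≤δ v w) (≡.trans (cong (λ y → 1ℤ + (δ v w - y) - 1ℤ) (δ-≢ u≢w)) (ring (δ v w))))
    where ring : ∀ x → 1ℤ + (x - 0ℤ) - 1ℤ ≡ x
          ring = solve-∀

-- From lists of arcs to antimagic orientations

tot-σ-pairs : ∀ (h : Arc n → ℤ) (u v : Fin n) →
  tot (λ e → h e * σ u v e) (cartesianProduct (allFin n) (allFin n)) ≡ h (u , v) + h (v , u)
tot-σ-pairs {n} h u v =
  ≡.trans (tot-× (λ e → h e * σ u v e) (allFin n) (allFin n))
  (≡.trans (tot-ext inner (allFin n))
  (≡.trans (tot-+ (λ a → h (a , v) * δ a u) (λ a → h (a , u) * δ a v) (allFin n))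
  (cong₂ _+_ (tot-δ-allFin (λ a → h (a , v)) u) (tot-δ-allFin (λ a → h (a , u)) v))))
  where
  ring : ∀ h p q r s → h * (p * q + r * s) ≡ h * p * q + h * r * s
  ring = solve-∀
  inner : ∀ a → tot (λ b → h (a , b) * σ u v (a , b)) (allFin n) ≡ h (a , v) * δ a u + h (a , u) * δ a v
  inner a =
    ≡.trans (tot-ext (λ b → ≡.trans (cong (h (a , b) *_) (σ-def u v a b))
                               (ring (h (a , b)) (δ a u) (δ b v) (δ a v) (δ b u))) (allFin n))
    (≡.trans (tot-+ (λ b → h (a , b) * δ a u * δ b v) (λ b → h (a , b) * δ a v * δ b u) (allFin n))
    (cong₂ _+_ (tot-δ-allFin (λ b → h (a , b) * δ a u) v) (tot-δ-allFin (λ b → h (a , b) * δ a v) u)))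

edgeList : (Fin n → Fin n → Bool) → List (Arc n)
edgeList {n} g = filterᵇ (λ (a , b) → does (a <? b) ∧ g a b) (cartesianProduct (allFin n) (allFin n))

tot-σ-edges : (g : Fin n → Fin n → Bool) → (∀ u v → g u v ≡ g v u) → (∀ v → g v v ≡ false) →
  ∀ u v → tot (σ u v) (edgeList g) ≡ ⟦ g u v ⟧
tot-σ-edges {n} g g-sym g-irrefl u v =
  ≡.trans (tot-filter (σ u v) p (cartesianProduct (allFin n) (allFin n)))
  (≡.trans (tot-σ-pairs (λ e → ⟦ p e ⟧) u v) once)
  where
  p : Arc n → Bool
  p (a , b) = does (a <? b) ∧ g a b
  once : ⟦ does (u <? v) ∧ g u v ⟧ + ⟦ does (v <? u) ∧ g v u ⟧ ≡ ⟦ g u v ⟧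
  once with <-cmp u v
  ... | tri< u<v _ v≮u rewrite dec-true (u <? v) u<v | dec-false (v <? u) v≮u = ℤ.+-identityʳ _
  ... | tri> u≮v _ v<u rewrite dec-false (u <? v) u≮v | dec-true (v <? u) v<u | g-sym u v = ℤ.+-identityˡ _
  ... | tri≈ u≮v refl _ rewrite dec-false (u <? u) u≮v | g-irrefl u = refl

tot-∑ : (g : Fin n → ℕ) → pos (∑[ v < n ] g v) ≡ tot (λ v → pos (g v)) (allFin n)
tot-∑ {ℕ.zero} g = refl
tot-∑ {suc n}  g = cong (pos (g zero) +_)
  (≡.trans (tot-∑ (g ∘ suc)) (sym (tot-tabulate (λ v → pos (g v)) suc)))

tot-∣∣ : (g : Fin n → Bool) → pos ∣ tabulate g ∣ ≡ tot (λ v → ⟦ g v ⟧) (allFin n)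
tot-∣∣ {ℕ.zero} g = refl
tot-∣∣ {suc n}  g with g zero | ≡.trans (tot-∣∣ (g ∘ suc)) (sym (tot-tabulate (λ v → ⟦ g v ⟧) suc))
... | true  | eq = cong (1ℤ +_) eq
... | false | eq = ≡.trans eq (sym (ℤ.+-identityˡ _))

pos-length : (as : List X) → pos (length as) ≡ len as
pos-length []       = refl
pos-length (a ∷ as) = cong (1ℤ +_) (pos-length as)

-- The label of one occurrence, in the convention of `wt`.
rank : ∀ {a : X} {as} → a ∈ as → ℤ
rank {as = as} (here _)  = len as
rank           (there p) = rank p

1≤rank : ∀ {a : X} {as} (p : a ∈ as) → 1ℤ ≤ rank p
1≤rank {as = _ ∷ as} (here _)  = ≤-from _ (0≤len as) (ring (len as))
  where ring : ∀ l → 1ℤ + l - 1ℤ ≡ l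
        ring = solve-∀
1≤rank               (there p) = 1≤rank p

rank≤len : ∀ {a : X} {as} (p : a ∈ as) → rank p ≤ len as
rank≤len               (here _)  = ℤ.≤-refl
rank≤len {as = _ ∷ as} (there p) = ℤ.i≤j⇒i≤1+j (rank≤len p)

position : ∀ {a : X} {as} → a ∈ as → Fin (length as)
position {as = _ ∷ as} (here _)  = fromℕ (length as)
position               (there p) = inject₁ (position p)

rank-position : ∀ {a : X} {as} (p : a ∈ as) → rank p ≡ pos (suc (toℕ (position p)))
rank-position {as = _ ∷ as} (here _)  =
  cong (1ℤ +_) (≡.trans (sym (pos-length as)) (cong pos (sym (toℕ-fromℕ (length as)))))
rank-position               (there p) =
  ≡.trans (rank-position p) (cong (pos ∘ suc) (sym (toℕ-inject₁ (position p))))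

position-injective : ∀ {as} {a b : X} (p : a ∈ as) (q : b ∈ as) → position p ≡ position q → a ≡ b
position-injective (here refl) (here refl) _  = refl
position-injective (here _)    (there q)   eq = contradiction eq fromℕ≢inject₁
position-injective (there p)   (here _)    eq = contradiction (sym eq) fromℕ≢inject₁
position-injective (there p)   (there q)   eq = position-injective p q (inject₁-injective eq)

position-surjective : ∀ (as : List X) i → ∃[ a ] ∃[ p ] position {a = a} {as} p ≡ i
position-surjective (a ∷ as) i with ℕ.m≤n⇒m<n∨m≡n (ℕ.s≤s⁻¹ (toℕ<n i))
... | inj₂ i≡len = a , here refl , toℕ-injective (≡.trans (toℕ-fromℕ _) (sym i≡len))
... | inj₁ i<len with b , p , eq ← position-surjective as (fromℕ< i<len) =
  b , there p , toℕ-injective (≡.trans (toℕ-inject₁ _)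
    (≡.trans (cong toℕ eq) (toℕ-fromℕ< i<len)))

-- A nonnegative `φ` with total at most 1 and value 1 at one occurrence vanishes at all others, so
-- the weighted sum reads off a single label.
wt-at : ∀ {φ : X → ℤ} → (∀ a → 0ℤ ≤ φ a) → ∀ {a as} (p : a ∈ as) → φ a ≡ 1ℤ → tot φ as ≤ 1ℤ →
  wt φ as ≡ rank p
wt-at {φ = φ} φ≥0 {as = _ ∷ as} (here {a} refl) φa≡1 ≤1 =
  ≡.trans (cong₂ _+_ (cong (_* len (a ∷ as)) φa≡1) (wt-zero as (tot≡0⇒All φ≥0 as rest≡0)))
  (≡.trans (ℤ.+-identityʳ (1ℤ * len (a ∷ as))) (ℤ.*-identityˡ (len (a ∷ as))))
  where
  ring : ∀ x t → 0ℤ - t ≡ (1ℤ - (x + t)) + (x - 1ℤ)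
  ring = solve-∀
  rest≡0 : tot φ as ≡ 0ℤ
  rest≡0 = ℤ.≤-antisym (≤-by (0≤- ≤1) φa≡1 (ring (φ a) (tot φ as))) (0≤tot φ≥0 as)
wt-at {φ = φ} φ≥0 {a} {b ∷ as} (there p) φa≡1 ≤1 =
  ≡.trans (cong (_+ wt φ as) (≡.trans (cong (_* len (b ∷ as)) φb≡0) (ℤ.*-zeroˡ (len (b ∷ as)))))
  (≡.trans (ℤ.+-identityˡ (wt φ as))
    (wt-at φ≥0 p φa≡1 (ℤ.≤-trans (≤-from _ (φ≥0 b) (ring (φ b) (tot φ as))) ≤1)))
  where
  ring : ∀ x t → x + t - t ≡ x
  ring = solve-∀
  ring′ : ∀ x t → 0ℤ - x ≡ (1ℤ - (x + t)) + (t - 1ℤ)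
  ring′ = solve-∀
  φb≡0 : φ b ≡ 0ℤ
  φb≡0 = ℤ.≤-antisym
    (≤-from _ (0≤+ (0≤- ≤1) (0≤- (subst (_≤ tot φ as) φa≡1 (≤tot φ≥0 p)))) (ring′ (φ b) (tot φ as))) (φ≥0 b)

-- `covers` makes every edge of `G` occur once, in one direction only; on the diagonal it excludes
-- loops.
module Realise {n} (G : Graph n) (L : List (Arc n))
  (covers : ∀ u v → tot (σ u v) L ≡ ⟦ Graph.adj G u v ⟧)
  (net-injective : ∀ u v → net L u ≡ net L v → u ≡ v) where

  open Graph G using (adj)

  infix 4 _∈?_
  _∈?_ : (e : Arc n) (L : List (Arc n)) → Dec (e ∈ L)
  e ∈? L = Any.any? (≡-dec _≟_ _≟_ e) L

  D : Digraph n
  D = record { arc = λ u v → ⌊ (u , v) ∈? L ⌋ }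

  open Digraph D using (arc)

  arc⇒∈ : ∀ {u v} → T (arc u v) → (u , v) ∈ L
  arc⇒∈ {u} {v} = toWitness

  ∈⇒arc : ∀ {u v} → (u , v) ∈ L → T (arc u v)
  ∈⇒arc {u} {v} = fromWitness

  -- Bounding the two directions together yields both asymmetry and the absence of repeated arcs.
  both≤1 : ∀ u v → tot (κ u v) L + tot (κ v u) L ≤ 1ℤ
  both≤1 u v = subst (_≤ 1ℤ) (≡.trans (sym (covers u v)) (tot-σ u v L)) (⟦⟧≤1 (adj u v))

  ∈⇒1≤ : ∀ {u v} → (u , v) ∈ L → 1ℤ ≤ tot (κ u v) L
  ∈⇒1≤ {u} {v} e∈L = subst (_≤ tot (κ u v) L) (κ-refl u v) (≤tot (0≤κ u v) e∈L)

  κ≤1 : ∀ u v → tot (κ u v) L ≤ 1ℤ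
  κ≤1 u v = ℤ.≤-trans (≤-from _ (0≤tot (0≤κ v u) L) (ring (tot (κ u v) L) (tot (κ v u) L))) (both≤1 u v)
    where ring : ∀ p q → p + q - p ≡ q
          ring = solve-∀

  ∉⇒κ≡0 : ∀ {u v} → ¬ (u , v) ∈ L → tot (κ u v) L ≡ 0ℤ
  ∉⇒κ≡0 {u} {v} e∉L with tot (κ u v) L ℤ.≟ 0ℤ
  ... | yes z = z
  ... | no nz with f , f∈L , κf≢0 ← tot≢0⇒∃ L nz with refl ← κ≢0⇒≡ κf≢0 = contradiction f∈L e∉L

  adj⇒∈ : ∀ {u v} → T (adj u v) → (u , v) ∈ L ⊎ (v , u) ∈ L
  adj⇒∈ {u} {v} t with adj u v | covers u v
  ... | true | eq with e , e∈L , σe≢0 ← tot≢0⇒∃ L (λ z → 1≤⇒≢0 ℤ.≤-refl (≡.trans (sym eq) z))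
                  with σ≢0⇒≡ {u = u} {v} {e} σe≢0
  ... | inj₁ refl = inj₁ e∈L
  ... | inj₂ refl = inj₂ e∈L

  ∈⇒adj : ∀ {u v} → (u , v) ∈ L → T (adj u v)
  ∈⇒adj {u} {v} uv∈L with adj u v | covers u v
  ... | true  | _  = _
  ... | false | eq = contradiction eq (∈⇒σ≢0 uv∈L)

  isOrientation : IsOrientation G D
  isOrientation = record
    { underlying = λ u v → mk⇔
        (λ t → [ (λ p → inj₁ (∈⇒arc p)) , (λ p → inj₂ (∈⇒arc p)) ]′ (adj⇒∈ t))
        [ (λ t → ∈⇒adj (arc⇒∈ t))
        , (λ t → subst T (Graph.sym G v u) (∈⇒adj (arc⇒∈ t))) ]′
    ; asymmetric = λ u v uv vu → contradiction
        (ℤ.≤-trans (ℤ.+-mono-≤ (∈⇒1≤ (arc⇒∈ uv)) (∈⇒1≤ (arc⇒∈ vu))) (both≤1 u v))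
        (λ { (+≤+ (ℕ.s≤s ())) })
    }

  arc-κ : ∀ u v → ⟦ arc u v ⟧ ≡ tot (κ u v) L
  arc-κ u v with (u , v) ∈? L
  ... | yes p = ℤ.≤-antisym (∈⇒1≤ p) (κ≤1 u v)
  ... | no ¬p = sym (∉⇒κ≡0 ¬p)

  tot-κ-head : ∀ a (e : Arc n) → tot (λ v → κ a v e) (allFin n) ≡ δ (proj₁ e) a
  tot-κ-head a (c , d) = ≡.trans
    (tot-ext (λ v → ≡.trans (κ-def a v c d) (cong (δ c a *_) (δ-sym d v))) (allFin n))
    (tot-δ-allFin (λ _ → δ c a) d)

  tot-κ-tail : ∀ b (e : Arc n) → tot (λ v → κ v b e) (allFin n) ≡ δ (proj₂ e) b
  tot-κ-tail b (c , d) = ≡.trans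
    (tot-ext (λ v → ≡.trans (κ-def v b c d)
      (≡.trans (ℤ.*-comm (δ c v) (δ d b)) (cong (δ d b *_) (δ-sym c v)))) (allFin n))
    (tot-δ-allFin (λ _ → δ d b) c)

  arcCount≡length : arcCount D ≡ length L
  arcCount≡length = ℤ.+-injective (≡.trans (tot-∑ (λ u → ∣ tabulate (arc u) ∣))
    (≡.trans (tot-ext (λ u → ≡.trans (tot-∣∣ (arc u)) (≡.trans (tot-ext (arc-κ u) (allFin n))
                (≡.trans (tot-swap (κ u) (allFin n) L)
                         (tot-ext (tot-κ-head u) L)))) (allFin n))
    (≡.trans (tot-swap (λ u e → δ (proj₁ e) u) (allFin n) L)
    (≡.trans (tot-ext tail-once L) (sym (pos-length L))))))
    where
    tail-once : ∀ (e : Arc n) → tot (λ u → δ (proj₁ e) u) (allFin n) ≡ 1ℤ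
    tail-once (c , d) = ≡.trans
      (tot-ext (λ u → ≡.trans (δ-sym c u) (sym (ℤ.*-identityˡ (δ u c)))) (allFin n))
      (tot-δ-allFin (λ _ → 1ℤ) c)

  wt-κ : ∀ {u v} (p : (u , v) ∈ L) → wt (κ u v) L ≡ pos (suc (toℕ (position p)))
  wt-κ {u} {v} p = ≡.trans (wt-at (0≤κ u v) p (κ-refl u v) (κ≤1 u v)) (rank-position p)

  index : A D → Fin (arcCount D)
  index (_ , t) = cast (sym arcCount≡length) (position (arc⇒∈ t))

  τ : A D ⤖ Fin (arcCount D)
  τ = mk⤖ (inj , surj)
    where
    cast-injective : ∀ {i j} → cast (sym arcCount≡length) i ≡ cast (sym arcCount≡length) j → i ≡ j
    cast-injective eq = toℕ-injective (≡.trans (sym (toℕ-cast _ _)) (≡.trans (cong toℕ eq) (toℕ-cast _ _)))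
    inj : ∀ {a b} → index a ≡ index b → a ≡ b
    inj {e , t} {f , t′} eq with refl ← position-injective {as = L} {a = e} {f} (arc⇒∈ t) (arc⇒∈ t′) (cast-injective eq) =
      cong (_ ,_) (T-irrelevant t t′)
    surj : ∀ i → ∃[ a ] (∀ {b} → b ≡ a → index b ≡ i)
    -- The membership proof recovered from the arc need not be `p` itself; both positions agree
    -- because `wt (κ u v) L` determines them.
    surj i with e , p , eq ← position-surjective L (cast arcCount≡length i) = (e , ∈⇒arc p) , λ { refl →
      toℕ-injective (≡.trans (toℕ-cast _ _) (≡.trans
        (ℕ.suc-injective (ℤ.+-injective (≡.trans (sym (wt-κ (arc⇒∈ (∈⇒arc p)))) (wt-κ p))))
        (≡.trans (cong toℕ eq) (toℕ-cast _ i)))) }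

  labelAt-wt : ∀ u v → pos (labelAt D (label D τ) u v) ≡ wt (κ u v) L
  labelAt-wt u v with T? (arc u v)
  ... | yes t = ≡.trans (cong (pos ∘ suc) (toℕ-cast _ (position (arc⇒∈ t)))) (sym (wt-κ (arc⇒∈ t)))
  ... | no ¬t = sym (wt-zero L (tot≡0⇒All (0≤κ u v) L (∉⇒κ≡0 (¬t ∘ ∈⇒arc))))

  s≡net : ∀ u → s D (label D τ) u ≡ net L u
  s≡net u = ≡.trans (cong₂ _-_ entering leaving)
    (≡.trans (cong (wt (λ e → δ (proj₂ e) u) L +_) (sym (wt-neg (λ e → δ (proj₁ e) u) L)))
             (sym (wt-+ (λ e → δ (proj₂ e) u) (λ e → - δ (proj₁ e) u) L)))
    where
    entering : pos (∑[ v < n ] labelAt D (label D τ) v u) ≡ wt (λ e → δ (proj₂ e) u) L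
    entering = ≡.trans (tot-∑ (λ v → labelAt D (label D τ) v u))
      (≡.trans (tot-ext (λ v → labelAt-wt v u) (allFin n))
      (≡.trans (wt-swap (λ v → κ v u) (allFin n) L) (wt-ext (tot-κ-tail u) L)))
    leaving : pos (∑[ v < n ] labelAt D (label D τ) u v) ≡ wt (λ e → δ (proj₁ e) u) L
    leaving = ≡.trans (tot-∑ (λ v → labelAt D (label D τ) u v))
      (≡.trans (tot-ext (labelAt-wt u) (allFin n))
      (≡.trans (wt-swap (λ v → κ u v) (allFin n) L) (wt-ext (tot-κ-head u) L)))

  antimagic : AdmitsAntimagicOrientation G
  antimagic = D , isOrientation , τ , λ {u} {v} eq →
    net-injective u v (≡.trans (sym (s≡net u)) (≡.trans eq (s≡net v)))

-- Orders with distinct sums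

rank-++ : ∀ {a : X} as {bs} (p : a ∈ as ++ bs) →
  (Σ[ q ∈ a ∈ as ] rank q + len bs ≡ rank p) ⊎ (Σ[ q ∈ a ∈ bs ] rank q ≡ rank p)
rank-++ []       p         = inj₂ (p , refl)
rank-++ (a ∷ as) {bs} (here refl) = inj₁ (here refl ,
  ≡.trans (ℤ.+-assoc 1ℤ (len as) (len bs)) (cong (1ℤ +_) (sym (tot-++ (λ _ → 1ℤ) as bs))))
rank-++ (a ∷ as) (there p) with rank-++ as p
... | inj₁ (q , eq) = inj₁ (there q , eq)
... | inj₂ r        = inj₂ r

-- With `f` the partial sums, `f u + rank` is the final s(u) up to a shift common to all tips. Ranks
-- belong to occurrences, so the condition is stated for membership proofs.
DistinctSums : (X → ℤ) → List X → Set
DistinctSums f vs = ∀ {u w} (p : u ∈ vs) (q : w ∈ vs) → f u + rank p ≡ f w + rank q → u ≡ w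

DistinctSums-++ : ∀ {f : X → ℤ} {as bs} → DistinctSums f as → DistinctSums f bs →
  (∀ {u w} (p : u ∈ as) (q : w ∈ bs) → f u + (rank p + len bs) ≢ f w + rank q) →
  DistinctSums f (as ++ bs)
DistinctSums-++ {f = f} {as} {bs} das dbs cross {u} {w} p q eq with rank-++ as p | rank-++ as q
... | inj₁ (p′ , ep) | inj₂ (q′ , eq′) =
  contradiction (≡.trans (cong (f u +_) ep) (≡.trans eq (cong (f w +_) (sym eq′)))) (cross p′ q′)
... | inj₂ (p′ , ep) | inj₁ (q′ , eq′) =
  contradiction (≡.trans (cong (f w +_) eq′) (≡.trans (sym eq) (cong (f u +_) (sym ep)))) (cross q′ p′)
... | inj₂ (p′ , ep) | inj₂ (q′ , eq′) =
  dbs p′ q′ (≡.trans (cong (f u +_) ep) (≡.trans eq (cong (f w +_) (sym eq′))))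
... | inj₁ (p′ , ep) | inj₁ (q′ , eq′) = das p′ q′
  (ℤ.i-j≡0⇒i≡j _ _ (≡.trans (ring (f u) (rank p′) (f w) (rank q′) (len bs))
    (ℤ.i≡j⇒i-j≡0 (≡.trans (cong (f u +_) ep) (≡.trans eq (cong (f w +_) (sym eq′)))))))
  where ring : ∀ a b c d l → a + b - (c + d) ≡ a + (b + l) - (c + (d + l))
        ring = solve-∀

DistinctSums-cong : ∀ {f g : X → ℤ} {vs} → (∀ {v} → v ∈ vs → f v ≡ g v) → DistinctSums f vs → DistinctSums g vs
DistinctSums-cong f≡g distinct p q eq = distinct p q
  (≡.trans (cong (_+ rank p) (f≡g p)) (≡.trans eq (cong (_+ rank q) (sym (f≡g q)))))

Above : (X → ℤ) → X → X → Set
Above f u w = f w ≤ f u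

-- The earlier element has the larger label and at least as large a value of `f`.
above⇒≢ : ∀ {f : X → ℤ} {as bs} → All (λ u → All (Above f u) bs) as →
  ∀ {u w} (p : u ∈ as) (q : w ∈ bs) → f u + (rank p + len bs) ≢ f w + rank q
above⇒≢ {f = f} {bs = bs} above {u} {w} p q eq = 1≰0 (≤-from
  (f u - f w + (rank p - 1ℤ + (len bs - rank q)))
  (0≤+ (0≤- (All.lookup (All.lookup above p) q)) (0≤+ (0≤- (1≤rank p)) (0≤- (rank≤len q))))
  (≡.trans (cong (λ z → z - 1ℤ) (sym (ℤ.i≡j⇒i-j≡0 eq))) (ring (f u) (rank p) (f w) (rank q) (len bs))))
  where ring : ∀ a b c d l → a + (b + l) - (c + d) - 1ℤ ≡ a - c + (b - 1ℤ + (l - d))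
        ring = solve-∀

Sorted : (X → ℤ) → List X → Set
Sorted f = AllPairs (Above f)

sorted⇒distinct : ∀ {f : X → ℤ} {vs} → Sorted f vs → DistinctSums f vs
sorted⇒distinct [] ()
sorted⇒distinct {f = f} {v ∷ vs} (v≥vs ∷ s) =
  DistinctSums-++ {f = f} {[ v ]} {vs} (λ { (here refl) (here refl) _ → refl }) (sorted⇒distinct s)
    (above⇒≢ {f = f} (v≥vs ∷ []))

AllPairs-++⁻ : ∀ {R : X → X → Set} as {bs} → AllPairs R (as ++ bs) →
  AllPairs R as × AllPairs R bs × All (λ a → All (R a) bs) as
AllPairs-++⁻ []       s       = [] , s , []
AllPairs-++⁻ (a ∷ as) (r ∷ s) with sas , sbs , cross ← AllPairs-++⁻ as s =
  All.++⁻ˡ as r ∷ sas , sbs , All.++⁻ʳ as r ∷ cross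

sort-desc : ∀ (f : X → ℤ) as → ∃[ vs ] vs ↭ as × Sorted f vs
sort-desc {X} f as = sort as , sort-↭ as ,
  AllPairs.map ℤ.neg-cancel-≤ (Linked⇒AllPairs ℤ.≤-trans (sort-↗ as))
  where open Sort (On.decTotalOrder ℤ.≤-decTotalOrder (λ (v : X) → - f v))

swap-blocks : ∀ {f : X → ℤ} A P Q {C} → Sorted f (A ++ (P ++ Q) ++ C) →
  (∀ {u w} (p : u ∈ Q) (q : w ∈ P) → f u + (rank p + len P) ≢ f w + rank q) →
  DistinctSums f (A ++ (Q ++ P) ++ C)
swap-blocks {f = f} A P Q {C} s cross
  with sA , sPQC , A≥ ← AllPairs-++⁻ A s
  with sPQ , sC , PQ≥C ← AllPairs-++⁻ (P ++ Q) sPQC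
  with sP , sQ , _ ← AllPairs-++⁻ P sPQ =
  DistinctSums-++ {f = f} {A} (sorted⇒distinct sA)
    (DistinctSums-++ {f = f} {Q ++ P} (DistinctSums-++ {f = f} {Q} {P} (sorted⇒distinct sQ) (sorted⇒distinct sP) cross)
      (sorted⇒distinct sC) (above⇒≢ {f = f} (flip PQ≥C)))
    (above⇒≢ {f = f} (All.map (λ a≥ → All.++⁺ (flip (All.++⁻ˡ (P ++ Q) a≥)) (All.++⁻ʳ (P ++ Q) a≥)) A≥))
  where
  flip : ∀ {R : _ → Set} → All R (P ++ Q) → All R (Q ++ P)
  flip r = All.++⁺ (All.++⁻ʳ P r) (All.++⁻ˡ P r)

-- The swap lowers each label in `P` by `len Q` and raises each label in `Q` by `len P`, so the
-- weighted sum changes by the difference of the two products.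
wt-swap-blocks : ∀ (g : X → ℤ) A P Q {C} → len Q * tot g P ≢ len P * tot g Q →
  wt g (A ++ (Q ++ P) ++ C) ≢ wt g (A ++ (P ++ Q) ++ C)
wt-swap-blocks g A P Q {C} neq eq = neq (ℤ.i-j≡0⇒i≡j _ _
  (≡.trans (ring (wt g A) (len P) (len Q) (len C) (tot g A) (wt g P) (wt g Q) (tot g P) (tot g Q) (wt g C))
    (≡.trans (cong₂ _-_ (sym (expand P Q)) (sym (expand Q P))) (ℤ.i≡j⇒i-j≡0 (sym eq)))))
  where
  expand : ∀ P Q → wt g (A ++ (P ++ Q) ++ C) ≡
    wt g A + (len P + len Q + len C) * tot g A +
      (wt g P + len Q * tot g P + wt g Q + len C * (tot g P + tot g Q) + wt g C)
  expand P Q rewrite wt-++ g A ((P ++ Q) ++ C) | wt-++ g (P ++ Q) C | wt-++ g P Q | tot-++ g P Q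
    | tot-++ (λ _ → 1ℤ) (P ++ Q) C | tot-++ (λ _ → 1ℤ) P Q = refl
  ring : ∀ a p q c ta wp wq tp tq wc → q * tp - p * tq ≡
    a + (p + q + c) * ta + (wp + q * tp + wq + c * (tp + tq) + wc) -
    (a + (q + p + c) * ta + (wq + p * tq + wp + c * (tq + tp) + wc))
  ring = solve-∀

⟦⟧+⟦not⟧ : ∀ b → ⟦ b ⟧ + ⟦ not b ⟧ ≡ 1ℤ
⟦⟧+⟦not⟧ true  = refl
⟦⟧+⟦not⟧ false = refl

tot-not : ∀ (cl : X → Bool) as → tot (λ v → ⟦ cl v ⟧) as + tot (λ v → ⟦ not (cl v) ⟧) as ≡ len as
tot-not cl as = ≡.trans (sym (tot-+ (λ v → ⟦ cl v ⟧) (λ v → ⟦ not (cl v) ⟧) as))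
  (tot-ext (λ v → ⟦⟧+⟦not⟧ (cl v)) as)

1≤tot : ∀ (cl : X → Bool) {a as} → a ∈ as → cl a ≡ true → 1ℤ ≤ tot (λ v → ⟦ cl v ⟧) as
1≤tot cl {a} {as} a∈as cla = subst (λ b → ⟦ b ⟧ ≤ tot (λ v → ⟦ cl v ⟧) as) cla (≤tot (λ v → 0≤⟦⟧ (cl v)) a∈as)

-- If `b` is false, `u` alone makes the sum positive; if `b` is true, the same argument applies to
-- the complementary colour.
tot-mixed : ∀ (cl : X → Bool) {u P} b {c} → u ∈ P → cl u ≢ b → c ≡ ⟦ b ⟧ → tot (λ v → ⟦ cl v ⟧) P ≢ len P * c
tot-mixed cl {u} {P} false {c} u∈P u≢b c≡0 eq = ⊥-by (0≤- (1≤tot cl u∈P (Bool.¬-not u≢b)))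
  (≡.trans (sym (≡.trans (cong (len P *_) c≡0) (ℤ.*-zeroʳ (len P)))) (sym eq))
  (ring (tot (λ v → ⟦ cl v ⟧) P))
  where ring : ∀ t → - 1ℤ ≡ t - 1ℤ + (0ℤ - t)
        ring = solve-∀
tot-mixed cl {u} {P} true {c} u∈P u≢b c≡1 eq = ⊥-by (0≤- (1≤tot (λ v → not (cl v)) u∈P (cong not (Bool.¬-not u≢b))))
  (cong₂ _+_ (≡.trans eq (≡.trans (cong (len P *_) c≡1) (ℤ.*-identityʳ (len P)))) (sym (tot-not cl P)))
  (ring (tot (λ v → ⟦ cl v ⟧) P) (tot (λ v → ⟦ not (cl v) ⟧) P) (len P))
  where ring : ∀ t s l → - 1ℤ ≡ s - 1ℤ + (t + l - (l + (t + s)))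
        ring = solve-∀

colour-change : ∀ (cl : X → Bool) {v w : X} {vs} → w ∈ vs → cl v ≢ cl w →
  ∃[ A ] ∃[ a ] ∃[ b ] ∃[ C ] v ∷ vs ≡ A ++ a ∷ b ∷ C × cl a ≢ cl b
colour-change cl {v} (here refl) v≢w = [] , v , _ , _ , refl , v≢w
colour-change cl {v} {vs = x ∷ vs} (there w∈vs) v≢w with cl v Bool.≟ cl x
... | no  v≢x = [] , v , x , vs , refl , v≢x
... | yes v≡x with A , a , b , C , eq , a≢b ← colour-change cl {x} w∈vs (λ x≡w → v≢w (≡.trans v≡x x≡w)) =
  v ∷ A , a , b , C , cong (v ∷_) eq , a≢b

colour-change′ : ∀ (cl : X → Bool) {u w : X} {vs} → u ∈ vs → w ∈ vs → cl u ≢ cl w →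
  ∃[ A ] ∃[ a ] ∃[ b ] ∃[ C ] vs ≡ A ++ a ∷ b ∷ C × cl a ≢ cl b
colour-change′ cl (here refl) (here refl) u≢w = contradiction refl u≢w
colour-change′ cl (here refl) (there q)   u≢w = colour-change cl q u≢w
colour-change′ cl (there p)   (here refl) u≢w = colour-change cl p (λ e → u≢w (sym e))
colour-change′ cl {vs = v ∷ vs} (there p) (there q) u≢w
  with A , a , b , C , eq , a≢b ← colour-change′ cl p q u≢w = v ∷ A , a , b , C , cong (v ∷_) eq , a≢b

first-deviation : ∀ (f : X → ℤ) t as → All (λ a → f a ≡ t) as ⊎
  ∃[ B ] ∃[ z ] ∃[ C ] as ≡ B ++ z ∷ C × All (λ a → f a ≡ t) B × f z ≢ t
first-deviation f t []       = inj₁ []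
first-deviation f t (a ∷ as) with f a ℤ.≟ t
... | no  a≢t = inj₂ ([] , a , as , refl , [] , a≢t)
... | yes a≡t with first-deviation f t as
...   | inj₁ all                          = inj₁ (a≡t ∷ all)
...   | inj₂ (B , z , C , refl , allB , z≢t) = inj₂ (a ∷ B , z , C , refl , a≡t ∷ allB , z≢t)

last-deviation : ∀ (f : X → ℤ) t as → All (λ a → f a ≡ t) as ⊎
  ∃[ A ] ∃[ z ] ∃[ B ] as ≡ A ++ z ∷ B × f z ≢ t × All (λ a → f a ≡ t) B
last-deviation f t []       = inj₁ []
last-deviation f t (a ∷ as) with last-deviation f t as
... | inj₂ (A , z , B , refl , z≢t , allB) = inj₂ (a ∷ A , z , B , refl , z≢t , allB)
... | inj₁ all with f a ℤ.≟ t
...   | yes a≡t = inj₁ (a≡t ∷ all)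
...   | no  a≢t = inj₂ ([] , a , as , refl , a≢t , all)

tot-const : ∀ {f : X → ℤ} {t} as → All (λ a → f a ≡ t) as → tot f as ≡ t * len as
tot-const {t = t} []       []       = sym (ℤ.*-zeroʳ t)
tot-const {t = t} (a ∷ as) (refl ∷ all) = ≡.trans (cong (t +_) (tot-const as all)) (ring t (len as))
  where ring : ∀ t l → t + t * l ≡ t * (1ℤ + l)
        ring = solve-∀

≤∧≢⇒+1≤ : ∀ {i j} → i ≤ j → j ≢ i → i + 1ℤ ≤ j
≤∧≢⇒+1≤ {i} i≤j j≢i = subst (_≤ _) (ℤ.+-comm 1ℤ i) (ℤ.i<j⇒suc[i]≤j (ℤ.≤∧≢⇒< i≤j (λ e → j≢i (sym e))))

-- For t ≥ 0 the upper level makes the sum positive, for t ≤ -1 the lower level makes it negative.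
-- Both levels are nonempty, hence the summands `1ℤ`.
two-levels : ∀ t {a c} → 0ℤ ≤ a → 0ℤ ≤ c → (t + 1ℤ) * (1ℤ + a) + t * (1ℤ + c) ≢ 0ℤ
two-levels t {a} {c} a≥0 c≥0 eq = [ nonnegative , negative ]′ (toSum (0ℤ ℤ.≤? t))
  where
  ring₊ : ∀ t a c → - 1ℤ ≡ a + t * (1ℤ + a + (1ℤ + c)) + (0ℤ - ((t + 1ℤ) * (1ℤ + a) + t * (1ℤ + c)))
  ring₊ = solve-∀
  ring₋ : ∀ t a c → - 1ℤ ≡
    c + (0ℤ - (1ℤ + t)) * (1ℤ + a + (1ℤ + c)) + ((t + 1ℤ) * (1ℤ + a) + t * (1ℤ + c) - 0ℤ)
  ring₋ = solve-∀
  size≥0 : 0ℤ ≤ 1ℤ + a + (1ℤ + c)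
  size≥0 = 0≤+ (0≤+ 0≤1 a≥0) (0≤+ 0≤1 c≥0)
  nonnegative : 0ℤ ≤ t → ⊥
  nonnegative t≥0 = ⊥-by (0≤+ a≥0 (0≤* t≥0 size≥0)) (sym eq) (ring₊ t a c)
  negative : ¬ 0ℤ ≤ t → ⊥
  negative t≱0 = ⊥-by (0≤+ c≥0 (0≤* (0≤- 1+t≤0) size≥0)) eq (ring₋ t a c)
    where
    1+t≤0 : 1ℤ + t ≤ 0ℤ
    1+t≤0 = ℤ.i<j⇒suc[i]≤j (ℤ.≰⇒> t≱0)

-- For `cl = adj x` the weighted sum is, up to a constant, the sum of the spoke labels at x;
-- changing it is what breaks a tie of the hubs.
Reordering : (X → ℤ) → (X → Bool) → List X → Set
Reordering f cl vs =
  ∃[ vs′ ] vs′ ↭ vs × DistinctSums f vs′ × wt (λ v → ⟦ cl v ⟧) vs′ ≢ wt (λ v → ⟦ cl v ⟧) vs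

module _ {X : Set} (f : X → ℤ) (cl : X → Bool) where

  private
    g : X → ℤ
    g v = ⟦ cl v ⟧

  reorder-blocks : ∀ A P Q {C vs} → vs ≡ A ++ (P ++ Q) ++ C → Sorted f vs →
    (∀ {u w} (p : u ∈ Q) (q : w ∈ P) → f u + (rank p + len P) ≢ f w + rank q) →
    len Q * tot g P ≢ len P * tot g Q → Reordering f cl vs
  reorder-blocks A P Q {C} refl s cross neq = A ++ (Q ++ P) ++ C ,
    ++⁺ˡ A (++⁺ʳ C (++-comm Q P)) , swap-blocks A P Q s cross , wt-swap-blocks g A P Q neq

  last-mixed : ∀ {u w P} → u ∈ P → cl u ≢ cl w → len [ w ] * tot g P ≢ len P * tot g [ w ]
  last-mixed {w = w} {P} u∈P u≢w eq = tot-mixed cl (cl w) {tot g [ w ]} u∈P u≢w (ℤ.+-identityʳ (g w))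
    (≡.trans (sym (≡.trans (cong (_* tot g P) {len [ w ]} {1ℤ} refl) (ℤ.*-identityˡ (tot g P)))) eq)

  -- After the swap `w` has the label next above that of `u`, so their sums collide only if `f u` is
  -- `f w + 1`.
  swap-adjacent : ∀ A {u w C} → Sorted f (A ++ u ∷ w ∷ C) → cl u ≢ cl w → f u ≢ f w + 1ℤ →
    Reordering f cl (A ++ u ∷ w ∷ C)
  swap-adjacent A {u} {w} s u≢w fu≢ = reorder-blocks A [ u ] [ w ] refl s
    (λ { (here refl) (here refl) e → fu≢ (ℤ.i-j≡0⇒i≡j _ _
      (≡.trans (ring (f u) (f w)) (ℤ.i≡j⇒i-j≡0 (sym e)))) })
    (last-mixed {u} {w} {[ u ]} (here refl) u≢w)
    where ring : ∀ a b → a - (b + 1ℤ) ≡ a + (1ℤ + 0ℤ) - (b + ((1ℤ + 0ℤ) + (1ℤ + 0ℤ)))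
          ring = solve-∀

  -- Let l be the length of `B ++ [ u ]`. In front of `z`, the sum of `w` is f(u) + l + 1 up to a
  -- shift. The elements at level f(u) have at most f(u) + l, and `z` has at least f(u) + l + 2. The
  -- colours in `B` do not matter: `u` makes the block differ from `w`.
  jump-up : ∀ A {z} B {u w C} → Sorted f ((A ++ z ∷ B) ++ u ∷ w ∷ C) → cl u ≢ cl w → f u ≡ f w + 1ℤ →
    All (λ b → f b ≡ f u) B → f z ≢ f u → Reordering f cl ((A ++ z ∷ B) ++ u ∷ w ∷ C)
  jump-up A {z} B {u} {w} {C} s u≢w fu≡ B≡ z≢ with _ , _ , above ← AllPairs-++⁻ (A ++ z ∷ B) s =
    reorder-blocks A ((z ∷ B) ++ [ u ]) [ w ]
      (≡.trans (++-assoc A (z ∷ B) (u ∷ w ∷ C)) (cong (A ++_) (regroup (z ∷ B)))) s cross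
      (last-mixed {u} {w} {(z ∷ B) ++ [ u ]} (∈-++⁺ʳ (z ∷ B) (here refl)) u≢w)
    where
    regroup : ∀ B → B ++ u ∷ w ∷ C ≡ ((B ++ [ u ]) ++ [ w ]) ++ C
    regroup []      = refl
    regroup (b ∷ B) = cong (b ∷_) (regroup B)
    fu+1≤fz : f u + 1ℤ ≤ f z
    fu+1≤fz = ≤∧≢⇒+1≤ (All.head (All.lookup above (∈-++⁺ʳ A (here refl)))) z≢
    level : All (λ b → f b ≡ f u) (B ++ [ u ])
    level = All.++⁺ B≡ (refl ∷ [])
    cross : ∀ {a b} (p : a ∈ [ w ]) (q : b ∈ (z ∷ B) ++ [ u ]) →
      f a + (rank p + len ((z ∷ B) ++ [ u ])) ≢ f b + rank q
    top : ∀ {z w u l} → u + 1ℤ ≤ z → u ≡ w + 1ℤ → w + (1ℤ + l) ≡ z + l → ⊥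
    top {z} {w} {u} {l} u<z u≡ e = ⊥-by (0≤- u<z) (cong₂ _+_ e u≡) (ring z w u l)
      where ring : ∀ z w u l → - 1ℤ ≡ z - (u + 1ℤ) + (w + (1ℤ + l) + u - (z + l + (w + 1ℤ)))
            ring = solve-∀
    lower : ∀ {b w u l r} → r ≤ l → u ≡ w + 1ℤ → b ≡ u → w + (1ℤ + (1ℤ + l)) ≡ b + r → ⊥
    lower {b} {w} {u} {l} {r} r≤l u≡ b≡ e =
      ⊥-by (0≤- r≤l) (cong₂ _+_ (sym e) (cong₂ _+_ (sym b≡) (sym u≡))) (ring b w u l r)
      where ring : ∀ b w u l r → - 1ℤ ≡ l - r + (b + r + (u + (w + 1ℤ)) - (w + (1ℤ + (1ℤ + l)) + (b + u)))
            ring = solve-∀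
    cross (here refl) (here refl) e = top {f z} {f w} {f u} {len (z ∷ B ++ [ u ])} fu+1≤fz fu≡ e
    cross {b = b} (here refl) (there q) e =
      lower {f b} {f w} {f u} {len (B ++ [ u ])} {rank q} (rank≤len q) fu≡ (All.lookup level q) e

  -- Behind `z`, the sum of `u` is f(w) + 2 up to a shift. The elements at level f(w) have labels
  -- from 3 on, so they exceed this, while `z` has at most f(w) + 1.
  jump-down : ∀ A {u w} B {z C} → Sorted f (A ++ u ∷ w ∷ B ++ z ∷ C) → cl u ≢ cl w → f u ≡ f w + 1ℤ →
    All (λ b → f b ≡ f w) B → f z ≢ f w → Reordering f cl (A ++ u ∷ w ∷ B ++ z ∷ C)
  jump-down A {u} {w} B {z} {C} s u≢w fu≡ B≡ z≢ with _ , _ ∷ w≥ ∷ _ , _ ← AllPairs-++⁻ A s =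
    reorder-blocks A [ u ] ((w ∷ B) ++ [ z ])
      (cong (λ D → A ++ u ∷ w ∷ D) (sym (++-assoc B [ z ] C))) s cross
      (λ e → last-mixed {w} {u} {(w ∷ B) ++ [ z ]} (here refl) (λ e → u≢w (sym e)) (sym e))
    where
    fz+1≤fw : f z + 1ℤ ≤ f w
    fz+1≤fw = ≤∧≢⇒+1≤ (All.lookup w≥ (∈-++⁺ʳ B (here refl))) (λ e → z≢ (sym e))
    cross : ∀ {a b} (p : a ∈ (w ∷ B) ++ [ z ]) (q : b ∈ [ u ]) → f a + (rank p + len [ u ]) ≢ f b + rank q
    upper : ∀ {a w u p q} → 1ℤ ≤ q → u ≡ w + 1ℤ → a ≡ w → q + 1ℤ ≡ p → a + (p + 1ℤ) ≡ u + 1ℤ → ⊥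
    upper {a} {w} {u} {p} {q} 1≤q u≡ a≡ p≡ e =
      ⊥-by (0≤- 1≤q) (cong₂ _+_ (sym e) (cong₂ _+_ (sym u≡) (cong₂ _+_ a≡ (sym p≡)))) (ring a w u p q)
      where ring : ∀ a w u p q → - 1ℤ ≡
                   q - 1ℤ + (u + 1ℤ + (w + 1ℤ + (a + p)) - (a + (p + 1ℤ) + (u + (w + (q + 1ℤ)))))
            ring = solve-∀
    bottom : ∀ {z w u p} → z + 1ℤ ≤ w → u ≡ w + 1ℤ → 1ℤ ≡ p → z + (p + 1ℤ) ≡ u + 1ℤ → ⊥
    bottom {z} {w} {u} {p} z<w u≡ p≡ e = ⊥-by (0≤- z<w) (cong₂ _+_ e (cong₂ _+_ u≡ p≡)) (ring z w u p)
      where ring : ∀ z w u p → - 1ℤ ≡ w - (z + 1ℤ) + (z + (p + 1ℤ) + (u + 1ℤ) - (u + 1ℤ + (w + 1ℤ + p)))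
            ring = solve-∀
    cross {a} p (here refl) e with rank-++ (w ∷ B) p
    ... | inj₁ (q , eq) =
      upper {f a} {f w} {f u} {rank p} {rank q} (1≤rank q) fu≡ (All.lookup (_∷_ {P = λ b → f b ≡ f w} refl B≡) q) eq e
    ... | inj₂ (here refl , eq) = bottom {f z} {f w} {f u} {rank p} fz+1≤fw fu≡ eq e

  -- At a colour change u,w of a sorted list, swap u and w if this keeps the sums distinct. Otherwise f u = f w + 1;
  -- then w may jump over the f u-level and one more element before it, or u over the f w-level and one more element
  -- after it. If there is no such element, f takes two consecutive values only and cannot sum to 0.
  reorder : ∀ {vs x y} → Sorted f vs → tot f vs ≡ 0ℤ → x ∈ vs → y ∈ vs → cl x ≢ cl y → Reordering f cl vs
  reorder s zero-sum x∈ y∈ x≢y with A , u , w , C , refl , u≢w ← colour-change′ cl x∈ y∈ x≢y with f u ℤ.≟ f w + 1ℤ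
  ... | no fu≢ = swap-adjacent A s u≢w fu≢
  ... | yes fu≡ with last-deviation f (f u) A | first-deviation f (f w) C
  ...   | inj₂ (A′ , z , B , refl , z≢ , B≡) | _ = jump-up A′ B s u≢w fu≡ B≡ z≢
  ...   | inj₁ _ | inj₂ (B , z , C′ , refl , B≡ , z≢) = jump-down A B s u≢w fu≡ B≡ z≢
  ...   | inj₁ A≡ | inj₁ C≡ = contradiction
    (≡.trans levels (≡.trans (sym (tot-++ f A (u ∷ w ∷ C))) zero-sum))
    (two-levels (f w) (0≤len A) (0≤len C))
    where
    ring : ∀ t a c → (t + 1ℤ) * (1ℤ + a) + t * (1ℤ + c) ≡ (t + 1ℤ) * a + (t + 1ℤ + (t + t * c))
    ring = solve-∀
    levels : (f w + 1ℤ) * (1ℤ + len A) + f w * (1ℤ + len C) ≡ tot f A + tot f (u ∷ w ∷ C)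
    levels = ≡.trans (ring (f w) (len A) (len C)) (sym (cong₂ _+_
      (≡.trans (tot-const A A≡) (cong (_* len A) fu≡))
      (cong₂ (λ p q → p + (f w + q)) fu≡ (tot-const C C≡))))

-- Spokes

true≢false : true ≢ false
true≢false ()

Enumerates : List (Fin n) → (Fin n → Bool) → Set
Enumerates {n} vs p = vs ↭ filterᵇ p (allFin n)

module _ {p : Fin n → Bool} {vs} (vs-p : Enumerates vs p) where

  tot-enum : ∀ φ → tot φ vs ≡ tot (λ v → ⟦ p v ⟧ * φ v) (allFin n)
  tot-enum φ = ≡.trans (tot-↭ φ vs-p) (tot-filter φ p (allFin n))

  tot-*δ : ∀ (c : Fin n → ℤ) v → tot (λ w → c w * δ w v) vs ≡ ⟦ p v ⟧ * c v
  tot-*δ c v = ≡.trans (tot-enum (λ w → c w * δ w v))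
    (≡.trans (tot-ext (λ w → sym (ℤ.*-assoc ⟦ p w ⟧ (c w) (δ w v))) (allFin n))
      (tot-δ-allFin (λ w → ⟦ p w ⟧ * c w) v))

  tot-δ : ∀ v → tot (λ w → δ w v) vs ≡ ⟦ p v ⟧
  tot-δ v = ≡.trans (tot-ext (λ w → sym (ℤ.*-identityˡ (δ w v))) vs)
    (≡.trans (tot-*δ (λ _ → 1ℤ) v) (ℤ.*-identityʳ ⟦ p v ⟧))

  ∈-enum⁺ : ∀ {v} → p v ≡ true → v ∈ vs
  ∈-enum⁺ {v} pv = ∈-resp-↭ (↭-sym vs-p) (∈-filter⁺ (T? ∘ p) (∈-allFin v) (Equivalence.from T-≡ pv))

  ∈-enum⁻ : ∀ {v} → v ∈ vs → p v ≡ true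
  ∈-enum⁻ v∈vs = Equivalence.to T-≡ (proj₂ (∈-filter⁻ (T? ∘ p) {xs = allFin n} (∈-resp-↭ vs-p v∈vs)))

  wt-δ-∈ : ∀ {v} (v∈vs : v ∈ vs) → wt (λ w → δ w v) vs ≡ rank v∈vs
  wt-δ-∈ {v} v∈vs = wt-at (λ w → 0≤δ w v) v∈vs (δ-≡ refl) (subst (_≤ 1ℤ) (sym (tot-δ v)) (⟦⟧≤1 (p v)))

sorted-enum : ∀ (f : Fin n → ℤ) p → ∃[ vs ] Enumerates vs p × Sorted f vs
sorted-enum {n} f p = sort-desc f (filterᵇ p (allFin n))

opaque
  -- The sum of the labels of as, weighted by φ, when m smaller labels are in use already.
  W : (X → ℤ) → List X → ℤ → ℤ
  W φ as m = wt φ as + m * tot φ as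

  W-def : ∀ (φ : X → ℤ) as m → W φ as m ≡ wt φ as + m * tot φ as
  W-def φ as m = refl

  wt-++-W : ∀ (φ : X → ℤ) as bs → wt φ (as ++ bs) ≡ W φ as (len bs) + wt φ bs
  wt-++-W φ as bs = wt-++ φ as bs

  W-map : ∀ (φ : Y → ℤ) (g : X → Y) as m → W φ (map g as) m ≡ W (λ a → φ (g a)) as m
  W-map φ g as m = cong₂ (λ p q → p + m * q) (wt-map φ g as) (tot-map φ g as)

  W-cong : ∀ {φ ψ : X → ℤ} {as} m → All (λ a → φ a ≡ ψ a) as → W φ as m ≡ W ψ as m
  W-cong {as = as} m e = cong₂ (λ p q → p + m * q) (wt-cong as e) (tot-cong as e)

  W-+ : ∀ (φ ψ : X → ℤ) as m → W (λ a → φ a + ψ a) as m ≡ W φ as m + W ψ as m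
  W-+ φ ψ as m = ≡.trans (cong₂ (λ p q → p + m * q) (wt-+ φ ψ as) (tot-+ φ ψ as))
    (ring (wt φ as) (wt ψ as) (tot φ as) (tot ψ as) m)
    where ring : ∀ p q r s m → p + q + m * (r + s) ≡ p + m * r + (q + m * s)
          ring = solve-∀

  W-neg : ∀ (φ : X → ℤ) as m → W (λ a → - φ a) as m ≡ - W φ as m
  W-neg φ as m = ≡.trans (cong₂ (λ p q → p + m * q) (wt-neg φ as) (tot-neg φ as))
    (ring (wt φ as) (tot φ as) m)
    where ring : ∀ p r m → - p + m * - r ≡ - (p + m * r)
          ring = solve-∀

  W-0 : ∀ {φ : X → ℤ} {as} m → All (λ a → φ a ≡ 0ℤ) as → W φ as m ≡ 0ℤ
  W-0 {φ = φ} {as} m z = ≡.trans (cong₂ (λ p q → p + m * q) (wt-zero as z) (≡.trans (tot-cong as z) (tot-0 as)))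
    (≡.trans (ℤ.+-identityˡ (m * 0ℤ)) (ℤ.*-zeroʳ m))

  0≤W : ∀ {φ : X → ℤ} {m} → 0ℤ ≤ m → (∀ a → 0ℤ ≤ φ a) → ∀ as → 0ℤ ≤ W φ as m
  0≤W m≥0 φ≥0 as = 0≤+ (0≤wt φ≥0 as) (0≤* m≥0 (0≤tot φ≥0 as))

  -- Already the smallest label available is `1 + m`, and the labels are weighted by at least one
  -- unit in total.
  1+m≤W : ∀ {φ : X → ℤ} {m} → 0ℤ ≤ m → (∀ a → 0ℤ ≤ φ a) → ∀ as → 1ℤ ≤ tot φ as → 1ℤ + m ≤ W φ as m
  1+m≤W {φ = φ} {m} m≥0 φ≥0 as 1≤t = ≤-from _
    (0≤+ (0≤- (tot≤wt φ≥0 as)) (0≤+ (0≤- 1≤t) (0≤* m≥0 (0≤- 1≤t)))) (ring (wt φ as) (tot φ as) m)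
    where ring : ∀ w t m → w + m * t - (1ℤ + m) ≡ w - t + (t - 1ℤ + m * (t - 1ℤ))
          ring = solve-∀

spokes : (Fin n → Fin n) → List (Fin n) → List (Arc n)
spokes h = map (λ v → h v , v)

tot-σ-spokes : ∀ (h : Fin n → Fin n) {p vs} → Enumerates vs p → ∀ u v →
  tot (σ u v) (spokes h vs) ≡ ⟦ p v ⟧ * δ (h v) u + ⟦ p u ⟧ * δ (h u) v
tot-σ-spokes h {vs = vs} vs-p u v =
  ≡.trans (tot-map (σ u v) (λ w → h w , w) vs)
  (≡.trans (tot-ext (λ w → σ-def u v (h w) w) vs)
  (≡.trans (tot-+ (λ w → δ (h w) u * δ w v) (λ w → δ (h w) v * δ w u) vs)
    (cong₂ _+_ (tot-*δ vs-p (λ w → δ (h w) u) v) (tot-*δ vs-p (λ w → δ (h w) v) u))))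

net-spokes : ∀ (h : Fin n → Fin n) vs M u →
  net (spokes h vs ++ M) u ≡ W (λ v → δ v u) vs (len M) - W (λ v → δ (h v) u) vs (len M) + net M u
net-spokes h vs M u = ≡.trans (wt-++-W (Δ u) (spokes h vs) M) (cong (_+ net M u)
  (≡.trans (W-map (Δ u) (λ v → h v , v) vs (len M))
  (≡.trans (W-+ (λ v → δ v u) (λ v → - δ (h v) u) vs (len M))
    (cong (W (λ v → δ v u) vs (len M) +_) (W-neg (λ v → δ (h v) u) vs (len M))))))

net-spokes-hub : ∀ (h : Fin n → Fin n) {p vs} M {u} → Enumerates vs p → p u ≡ false →
  net (spokes h vs ++ M) u ≡ net M u - W (λ v → δ (h v) u) vs (len M)
net-spokes-hub h {p} {vs} M {u} vs-p pu = ≡.trans (net-spokes h vs M u)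
  (≡.trans (cong (λ z → z - W (λ v → δ (h v) u) vs (len M) + net M u)
      (W-0 {φ = λ v → δ v u} (len M) (All.tabulate λ v∈vs → δ-≢ λ { refl → true≢false (≡.trans (sym (∈-enum⁻ vs-p v∈vs)) pu) })))
    (ring (W (λ v → δ (h v) u) vs (len M)) (net M u)))
  where ring : ∀ w m → 0ℤ - w + m ≡ m - w
        ring = solve-∀

net-spokes-tip : ∀ (h : Fin n → Fin n) {p vs} M {u} → Enumerates vs p → (∀ v → p (h v) ≡ false) →
  p u ≡ true → (u∈vs : u ∈ vs) → net (spokes h vs ++ M) u ≡ rank u∈vs + len M + net M u
net-spokes-tip h {p} {vs} M {u} vs-p hub pu u∈vs = ≡.trans (net-spokes h vs M u)
  (≡.trans (cong₂ (λ y z → y - z + net M u)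
      (≡.trans (W-def (λ v → δ v u) vs (len M)) (cong₂ (λ y z → y + len M * z) (wt-δ-∈ vs-p u∈vs)
        (≡.trans (tot-δ vs-p u) (cong ⟦_⟧ pu))))
      (W-0 {φ = λ v → δ (h v) u} {vs} (len M)
        (All.universal (λ v → δ-≢ λ { refl → true≢false (≡.trans (sym pu) (hub v)) }) vs)))
    (ring (rank u∈vs) (len M) (net M u)))
  where ring : ∀ r l m → r + l * 1ℤ - 0ℤ + m ≡ r + l + m
        ring = solve-∀

module _ (G : Graph n) (p : Fin n → Bool) (h : Fin n → Fin n) {vs} (M : List (Arc n))
  (vs-p : Enumerates vs p) (hub : ∀ v → p (h v) ≡ false) where

  private
    L : List (Arc n)
    L = spokes h vs ++ M

  -- The label of a tip exceeds `len M`, which outweighs a negative `net M`; between two tips the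
  -- shift `len M` cancels. What remains is to separate the vertices outside `p`, which may include
  -- one that is not a hub.
  realise : (∀ u v → tot (σ u v) L ≡ ⟦ Graph.adj G u v ⟧) →
    (∀ v → p v ≡ true → 0ℤ ≤ net M v + len M) → DistinctSums (net M) vs →
    (∀ u → p u ≡ false → net L u ≤ 0ℤ) →
    (∀ u v → p u ≡ false → p v ≡ false → net L u ≡ net L v → u ≡ v) →
    AdmitsAntimagicOrientation G
  realise covers bound distinct hub≤0 hubs-distinct = Realise.antimagic G L covers injective
    where
    tip : ∀ {u} (pu : p u ≡ true) → net L u ≡ rank (∈-enum⁺ vs-p pu) + len M + net M u
    tip pu = net-spokes-tip h M vs-p hub pu (∈-enum⁺ vs-p pu)
    tip≰hub : ∀ {u v} → p u ≡ true → p v ≡ false → net L u ≢ net L v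
    tip≰hub {u} {v} pu pv eq = ⊥-by (0≤+ (0≤- (1≤rank (∈-enum⁺ vs-p pu))) (0≤+ (bound u pu) (0≤- (hub≤0 v pv))))
      (cong₂ _+_ (tip pu) (sym eq))
      (ring (rank (∈-enum⁺ vs-p pu)) (net M u) (len M) (net L u) (net L v))
      where ring : ∀ r m l x y → - 1ℤ ≡ r - 1ℤ + (m + l + (0ℤ - y)) + (x + y - (r + l + m + x))
            ring = solve-∀
    tips : ∀ {u v} → p u ≡ true → p v ≡ true → net L u ≡ net L v → u ≡ v
    tips {u} {v} pu pv eq = distinct (∈-enum⁺ vs-p pu) (∈-enum⁺ vs-p pv)
      (≡-by (≡.trans (sym (tip pu)) (≡.trans eq (tip pv)))
        (ring (rank (∈-enum⁺ vs-p pu)) (rank (∈-enum⁺ vs-p pv)) (len M) (net M u) (net M v)))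
      where ring : ∀ r s l x y → x + r - (y + s) ≡ r + l + x - (s + l + y)
            ring = solve-∀
    injective : ∀ u v → net L u ≡ net L v → u ≡ v
    injective u v eq with p u in pu | p v in pv
    ... | true  | true  = tips pu pv eq
    ... | true  | false = contradiction eq (tip≰hub pu pv)
    ... | false | true  = contradiction (sym eq) (tip≰hub pv pu)
    ... | false | false = hubs-distinct u v pu pv eq

-- One hub

restrict : Graph n → (Fin n → Bool) → Fin n → Fin n → Bool
restrict G p u v = p u ∧ p v ∧ Graph.adj G u v

record InnerOrder (G : Graph n) (p : Fin n → Bool) : Set where
  field
    arcs  : List (Arc n)
    edges : ∀ u v → tot (σ u v) arcs ≡ ⟦ restrict G p u v ⟧
    bound : ∀ v → 0ℤ ≤ net arcs v + len arcs

inner-order : (G : Graph n) (p : Fin n → Bool) → InnerOrder G p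
inner-order G p with L , chips , same ← chip-order _ (edgeList (restrict G p)) refl = record
  { arcs  = L
  ; edges = λ u v → ≡.trans (same u v) (tot-σ-edges (restrict G p) g-sym g-irrefl u v)
  ; bound = λ v → subst (λ l → 0ℤ ≤ net L v + l) (ℤ.*-identityʳ (len L)) (Chips⇒net-bound chips v)
  }
  where
  open Graph G using (adj)
  g-sym : ∀ u v → restrict G p u v ≡ restrict G p v u
  g-sym u v with p u | p v
  ... | true  | true  = Graph.sym G u v
  ... | true  | false = refl
  ... | false | true  = refl
  ... | false | false = refl
  g-irrefl : ∀ v → restrict G p v v ≡ false
  g-irrefl v rewrite Graph.irrefl G v with p v
  ... | true  = refl
  ... | false = refl

module _ {G : Graph n} {p : Fin n → Bool} (O : InnerOrder G p) where
  open InnerOrder O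

  inner-ends : ∀ {a b} → (a , b) ∈ arcs → p a ≡ true × p b ≡ true
  inner-ends {a} {b} ab∈ with p a | p b | edges a b
  ... | true  | true  | _ = refl , refl
  ... | true  | false | z = contradiction z (∈⇒σ≢0 ab∈)
  ... | false | _     | z = contradiction z (∈⇒σ≢0 ab∈)

  net-outside : ∀ {u} → p u ≡ false → net arcs u ≡ 0ℤ
  net-outside {u} pu = wt-zero arcs (All.tabulate λ { {a , b} ab∈ → cong₂ _-_
    (δ-≢ λ { refl → true≢false (≡.trans (sym (proj₂ (inner-ends ab∈))) pu) })
    (δ-≢ λ { refl → true≢false (≡.trans (sym (proj₁ (inner-ends ab∈))) pu) }) })

  -- Both ends of an inner arc lie in `vs`, so its label is counted once with each sign.
  net-zero-sum : ∀ {vs} → Enumerates vs p → tot (net arcs) vs ≡ 0ℤ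
  net-zero-sum {vs} vs-p = ≡.trans (wt-swap Δ vs arcs) (wt-zero arcs (All.tabulate λ { {a , b} ab∈ →
    ≡.trans (tot-+ (λ v → δ b v) (λ v → - δ a v) vs)
      (cong₂ _+_ (count b (proj₂ (inner-ends ab∈)))
        (≡.trans (tot-neg (λ v → δ a v) vs) (cong -_ (count a (proj₁ (inner-ends ab∈)))))) }))
    where
    count : ∀ a → p a ≡ true → tot (λ v → δ a v) vs ≡ 1ℤ
    count a pa = ≡.trans (tot-ext (λ v → δ-sym a v) vs) (≡.trans (tot-δ vs-p a) (cong ⟦_⟧ pa))

module _ (G : Graph n) (x : Fin n) where
  open Graph G using (adj)

  -- Here the tips are the neighbours of `x`. At most one further vertex is left over; being
  -- isolated it has value 0, while the edge to `z` forces a negative value at `x`.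
  one-hub : (∃[ z ] adj x z ≡ true) →
    (∀ {u v} → u ≢ x → v ≢ x → adj x u ≡ false → adj x v ≡ false → u ≡ v) →
    (∀ {u} → u ≢ x → adj x u ≡ false → ∀ v → adj u v ≡ false) →
    AdmitsAntimagicOrientation G
  one-hub (z , xz) exception isolated =
    realise G p (λ _ → x) arcs vs-p (λ _ → Graph.irrefl G x) covers (λ v _ → bound v)
      (sorted⇒distinct sorted) hub≤0 hubs-distinct
    where
    p : Fin n → Bool
    p = adj x
    O : InnerOrder G p
    O = inner-order G p
    open InnerOrder O
    enum : ∃[ vs ] Enumerates vs p × Sorted (net arcs) vs
    enum = sorted-enum (net arcs) p
    vs : List (Fin n)
    vs = proj₁ enum
    vs-p : Enumerates vs p
    vs-p = proj₁ (proj₂ enum)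
    sorted : Sorted (net arcs) vs
    sorted = proj₂ (proj₂ enum)
    L : List (Arc n)
    L = spokes (λ _ → x) vs ++ arcs
    restrict≡ : ∀ {u v} → u ≢ x → v ≢ x → ⟦ p v ⟧ * 0ℤ + ⟦ p u ⟧ * 0ℤ + ⟦ restrict G p u v ⟧ ≡ ⟦ adj u v ⟧
    restrict≡ {u} {v} u≢x v≢x with adj x u in pu | adj x v in pv
    ... | true  | true  = ℤ.+-identityˡ ⟦ adj u v ⟧
    ... | true  | false = cong ⟦_⟧ (sym (≡.trans (Graph.sym G u v) (isolated v≢x pv u)))
    ... | false | true  = cong ⟦_⟧ (sym (isolated u≢x pu v))
    ... | false | false = cong ⟦_⟧ (sym (isolated u≢x pu v))
    cover : ∀ u v → ⟦ p v ⟧ * δ x u + ⟦ p u ⟧ * δ x v + ⟦ restrict G p u v ⟧ ≡ ⟦ adj u v ⟧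
    cover u v with u ≟ x | v ≟ x
    ... | yes refl | yes refl rewrite Graph.irrefl G x = cong₂ (λ a b → a + b + 0ℤ) (ℤ.*-zeroˡ (δ x x)) (ℤ.*-zeroˡ (δ x x))
    ... | yes refl | no v≢x rewrite Graph.irrefl G x =
      ≡.trans (cong₂ (λ a b → a + b + 0ℤ) (≡.trans (cong (⟦ p v ⟧ *_) (δ-≡ refl)) (ℤ.*-identityʳ ⟦ p v ⟧)) (ℤ.*-zeroˡ (δ x v)))
        (ring ⟦ p v ⟧)
      where ring : ∀ a → a + 0ℤ + 0ℤ ≡ a
            ring = solve-∀
    ... | no u≢x | yes refl rewrite Graph.irrefl G x | Bool.∧-zeroʳ (p u) =
      ≡.trans (cong₂ (λ a b → a + b + 0ℤ) (ℤ.*-zeroˡ (δ x u)) (≡.trans (cong (⟦ p u ⟧ *_) (δ-≡ refl)) (ℤ.*-identityʳ ⟦ p u ⟧)))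
        (≡.trans (ring ⟦ p u ⟧) (cong ⟦_⟧ (Graph.sym G x u)))
      where ring : ∀ a → 0ℤ + a + 0ℤ ≡ a
            ring = solve-∀
    ... | no u≢x | no v≢x = ≡.trans
      (cong₂ (λ a b → ⟦ p v ⟧ * a + ⟦ p u ⟧ * b + ⟦ restrict G p u v ⟧) (δ-≢ (u≢x ∘ sym)) (δ-≢ (v≢x ∘ sym)))
      (restrict≡ u≢x v≢x)
    covers : ∀ u v → tot (σ u v) L ≡ ⟦ adj u v ⟧
    covers u v = ≡.trans (tot-++ (σ u v) (spokes (λ _ → x) vs) arcs)
      (≡.trans (cong₂ _+_ (tot-σ-spokes (λ _ → x) vs-p u v) (edges u v)) (cover u v))
    net-hub : ∀ {u} → p u ≡ false → net L u ≡ - W (λ _ → δ x u) vs (len arcs)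
    net-hub {u} pu = ≡.trans (net-spokes-hub (λ _ → x) arcs vs-p pu)
      (≡.trans (cong (_- W (λ _ → δ x u) vs (len arcs)) (net-outside O pu)) (ℤ.+-identityˡ _))
    hub≤0 : ∀ u → p u ≡ false → net L u ≤ 0ℤ
    hub≤0 u pu = subst (_≤ 0ℤ) (sym (net-hub pu)) (ℤ.neg-mono-≤ (0≤W (0≤len arcs) (λ _ → 0≤δ x u) vs))
    net-x<0 : net L x ≤ - 1ℤ
    net-x<0 = subst (_≤ - 1ℤ) (sym (net-hub (Graph.irrefl G x))) (ℤ.neg-mono-≤
      (ℤ.≤-trans (ℤ.i≤i+j 1ℤ (len arcs) {{nonNegative (0≤len arcs)}})
        (1+m≤W (0≤len arcs) (λ _ → 0≤δ x x) vs
          (ℤ.≤-trans (ℤ.≤-reflexive (sym (δ-≡ refl))) (≤tot (λ _ → 0≤δ x x) (∈-enum⁺ vs-p xz))))))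
    net-exception : ∀ {u} → u ≢ x → p u ≡ false → net L u ≡ 0ℤ
    net-exception u≢x pu = ≡.trans (net-hub pu)
      (cong -_ (W-0 (len arcs) (All.universal (λ _ → δ-≢ (u≢x ∘ sym)) vs)))
    x≢exception : ∀ {u} → u ≢ x → p u ≡ false → net L x ≢ net L u
    x≢exception u≢x pu eq = ⊥-by (0≤- net-x<0) (≡.trans eq (net-exception u≢x pu)) (ring (net L x))
      where ring : ∀ a → - 1ℤ ≡ - 1ℤ - a + (a - 0ℤ)
            ring = solve-∀
    hubs-distinct : ∀ u v → p u ≡ false → p v ≡ false → net L u ≡ net L v → u ≡ v
    hubs-distinct u v pu pv eq with u ≟ x | v ≟ x
    ... | yes refl | yes refl = refl
    ... | yes refl | no v≢x   = contradiction eq (x≢exception v≢x pv)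
    ... | no u≢x   | yes refl = contradiction (sym eq) (x≢exception u≢x pu)
    ... | no u≢x   | no v≢x   = exception u≢x v≢x pu pv

-- Two hubs

-- `common` is a parameter with a defining equation rather than a definition, so that the same list
-- `cs` serves when x and y exchange roles.
module TwoHubs (G : Graph n) {p common : Fin n → Bool} (O : InnerOrder G p) {cs} (cs-common : Enumerates cs common)
  {x y : Fin n} (x≢y : x ≢ y) (px : p x ≡ false) (py : p y ≡ false)
  (hubs : ∀ {v} → p v ≡ false → v ≡ x ⊎ v ≡ y)
  (common-def : ∀ v → common v ≡ p v ∧ (Graph.adj G x v ∧ Graph.adj G y v))
  (dominated : ∀ {v} → p v ≡ true → Graph.adj G x v ≡ false → Graph.adj G y v ≡ true) where

  open Graph G using (adj)
  open InnerOrder O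

  h : Fin n → Fin n
  h v = if adj x v then x else y

  hub : ∀ v → p (h v) ≡ false
  hub v with adj x v
  ... | true  = px
  ... | false = py

  δ-h-x : ∀ v → δ (h v) x ≡ ⟦ adj x v ⟧
  δ-h-x v with adj x v
  ... | true  = δ-≡ refl
  ... | false = δ-≢ (x≢y ∘ sym)

  δ-h-y : ∀ v → δ (h v) y ≡ ⟦ not (adj x v) ⟧
  δ-h-y v with adj x v
  ... | true  = δ-≢ x≢y
  ... | false = δ-≡ refl

  not-common : ∀ {v} → p v ≡ false → common v ≡ false
  not-common {v} pv = ≡.trans (common-def v) (cong (_∧ (adj x v ∧ adj y v)) pv)

  -- The common neighbours have their large label on the edge to x and a smaller one on the edge to y.
  left : List (Arc n) → List (Arc n)
  left K = spokes (λ _ → y) cs ++ K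

  len-left : ∀ K → len (left K) ≡ len cs + len K
  len-left K = ≡.trans (tot-++ (λ _ → 1ℤ) (spokes (λ _ → y) cs) K)
    (cong (_+ len K) (tot-map (λ _ → 1ℤ) (λ v → y , v) cs))

  ≢hub : ∀ {u v} → p u ≡ false → p v ≡ true → u ≢ v
  ≢hub pu pv refl = true≢false (≡.trans (sym pv) pu)

  net-left-inner : ∀ K {u} → p u ≡ true → net (left K) u ≡ W (λ v → δ v u) cs (len K) + net K u
  net-left-inner K {u} pu = ≡.trans (net-spokes (λ _ → y) cs K u) (cong (_+ net K u)
    (≡.trans (cong (λ z → W (λ v → δ v u) cs (len K) - z) (W-0 {φ = λ _ → δ y u} (len K) (All.universal (λ _ → δ-≢ (≢hub py pu)) cs)))
      (ring (W (λ v → δ v u) cs (len K)))))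
    where ring : ∀ a → a - 0ℤ ≡ a
          ring = solve-∀

  net-left-x : ∀ K → net (left K) x ≡ net K x
  net-left-x K = ≡.trans (net-spokes-hub (λ _ → y) K cs-common (not-common px))
    (≡.trans (cong (λ z → net K x - z) (W-0 {φ = λ _ → δ y x} (len K) (All.universal (λ _ → δ-≢ (x≢y ∘ sym)) cs))) (ring (net K x)))
    where ring : ∀ a → a - 0ℤ ≡ a
          ring = solve-∀

  net-left-y : ∀ K → net (left K) y ≡ net K y - W (λ _ → 1ℤ) cs (len K)
  net-left-y K = ≡.trans (net-spokes-hub (λ _ → y) K cs-common (not-common py))
    (cong (λ z → net K y - z) (W-cong (len K) (All.universal (λ _ → δ-≡ refl) cs)))

  -- Explicit values of s(x) and s(y) for the list `spokes h vs ++ left K`; `net-x` and `net-y`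
  -- below verify them.
  out-x out-y : List (Fin n) → List (Arc n) → ℤ
  out-x vs K = net K x - W (λ v → ⟦ adj x v ⟧) vs (len cs + len K)
  out-y vs K = net K y - W (λ _ → 1ℤ) cs (len K) - W (λ v → ⟦ not (adj x v) ⟧) vs (len cs + len K)

  adj-y-split : ∀ {v} → p v ≡ true → ⟦ not (adj x v) ⟧ + ⟦ common v ⟧ ≡ ⟦ adj y v ⟧
  adj-y-split {v} pv = ≡.trans (cong (λ b → ⟦ not (adj x v) ⟧ + ⟦ b ⟧)
      (≡.trans (common-def v) (cong (_∧ (adj x v ∧ adj y v)) pv)))
    (split (adj x v) refl)
    where
    split : ∀ b → adj x v ≡ b → ⟦ not b ⟧ + ⟦ b ∧ adj y v ⟧ ≡ ⟦ adj y v ⟧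
    split true  _  = ℤ.+-identityˡ ⟦ adj y v ⟧
    split false xv = sym (cong ⟦_⟧ (dominated pv xv))

  private
    -- The number of spokes from the hub `u` to the tip `v`, large and small ones together.
    S : Fin n → Fin n → ℤ
    S v u = ⟦ p v ⟧ * δ (h v) u + ⟦ common v ⟧ * δ y u

    S-inner : ∀ v {u} → p u ≡ true → S v u ≡ 0ℤ
    S-inner v pu = ≡.trans (cong₂ (λ a b → ⟦ p v ⟧ * a + ⟦ common v ⟧ * b) (δ-≢ (≢hub (hub v) pu)) (δ-≢ (≢hub py pu)))
      (ring ⟦ p v ⟧ ⟦ common v ⟧)
      where ring : ∀ a b → a * 0ℤ + b * 0ℤ ≡ 0ℤ
            ring = solve-∀

    S-hub : ∀ {v} u → p v ≡ false → S v u ≡ 0ℤ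
    S-hub {v} u pv = ≡.trans (cong₂ (λ a b → ⟦ a ⟧ * δ (h v) u + ⟦ b ⟧ * δ y u) pv (not-common pv)) (ring (δ (h v) u) (δ y u))
      where ring : ∀ a b → 0ℤ * a + 0ℤ * b ≡ 0ℤ
            ring = solve-∀

    S-spoke : ∀ {u v} → p v ≡ true → u ≡ x ⊎ u ≡ y → S v u ≡ ⟦ adj u v ⟧
    S-spoke {v = v} pv (inj₁ refl) = ≡.trans
      (cong₂ _+_ (cong₂ (λ a b → ⟦ a ⟧ * b) pv (δ-h-x v)) (cong (⟦ common v ⟧ *_) (δ-≢ (x≢y ∘ sym))))
      (ring ⟦ adj x v ⟧ ⟦ common v ⟧)
      where ring : ∀ a b → 1ℤ * a + b * 0ℤ ≡ a
            ring = solve-∀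
    S-spoke {v = v} pv (inj₂ refl) = ≡.trans
      (cong₂ _+_ (cong₂ (λ a b → ⟦ a ⟧ * b) pv (δ-h-y v)) (cong (⟦ common v ⟧ *_) (δ-≡ refl)))
      (≡.trans (ring ⟦ not (adj x v) ⟧ ⟦ common v ⟧) (adj-y-split pv))
      where ring : ∀ a b → 1ℤ * a + b * 1ℤ ≡ a + b
            ring = solve-∀

  -- The edges that are not spokes: those between inner vertices, and xy if present.
  same-side : Fin n → Fin n → Bool
  same-side u v = not (p u xor p v) ∧ adj u v

  private
    cover : ∀ u v bu bv → p u ≡ bu → p v ≡ bv → S v u + S u v + ⟦ not (bu xor bv) ∧ adj u v ⟧ ≡ ⟦ adj u v ⟧
    cover u v true  true  pu pv = ≡.trans (cong₂ (λ a b → a + b + ⟦ adj u v ⟧) (S-inner v pu) (S-inner u pv)) (ℤ.+-identityˡ _)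
    cover u v false false pu pv = ≡.trans (cong₂ (λ a b → a + b + ⟦ adj u v ⟧) (S-hub u pv) (S-hub v pu)) (ℤ.+-identityˡ _)
    cover u v true  false pu pv = ≡.trans (cong₂ (λ a b → a + b + 0ℤ) (S-inner v pu) (S-spoke pu (hubs pv)))
      (≡.trans (ring ⟦ adj v u ⟧) (cong ⟦_⟧ (Graph.sym G v u)))
      where ring : ∀ a → 0ℤ + a + 0ℤ ≡ a
            ring = solve-∀
    cover u v false true  pu pv = ≡.trans (cong₂ (λ a b → a + b + 0ℤ) (S-spoke pv (hubs pu)) (S-inner u pv)) (ring ⟦ adj u v ⟧)
      where ring : ∀ a → a + 0ℤ + 0ℤ ≡ a
            ring = solve-∀

  -- `K` carries the smallest labels: the inner arcs and possibly an arc between the hubs. The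
  -- spokes at common neighbours raise inner values, so the bound survives the passage from `K` to
  -- `left K`.
  configuration : ∀ K {vs} → (∀ u v → tot (σ u v) K ≡ ⟦ same-side u v ⟧) →
    (∀ {v} → p v ≡ true → 0ℤ ≤ net K v + len K) →
    Enumerates vs p → DistinctSums (net (left K)) vs →
    out-x vs K ≤ 0ℤ → out-y vs K ≤ 0ℤ → out-x vs K ≢ out-y vs K → AdmitsAntimagicOrientation G
  configuration K {vs} K-edges K-bound vs-p distinct x≤0 y≤0 apart =
    realise G p h (left K) vs-p hub covers left-bound distinct
      (λ u pu → [ (λ { refl → subst (_≤ 0ℤ) (sym net-x) x≤0 }) , (λ { refl → subst (_≤ 0ℤ) (sym net-y) y≤0 }) ]′ (hubs pu))
      (λ u v pu pv eq → hubs-distinct (hubs pu) (hubs pv) eq)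
    where
    L : List (Arc n)
    L = spokes h vs ++ left K
    covers : ∀ u v → tot (σ u v) L ≡ ⟦ adj u v ⟧
    covers u v = ≡.trans (tot-++ (σ u v) (spokes h vs) (left K))
      (≡.trans (cong₂ _+_ (tot-σ-spokes h vs-p u v) (≡.trans (tot-++ (σ u v) (spokes (λ _ → y) cs) K)
        (cong₂ _+_ (tot-σ-spokes (λ _ → y) cs-common u v) (K-edges u v))))
      (≡.trans (ring (⟦ p v ⟧ * δ (h v) u) (⟦ p u ⟧ * δ (h u) v) (⟦ common v ⟧ * δ y u) (⟦ common u ⟧ * δ y v) ⟦ same-side u v ⟧)
        (cover u v (p u) (p v) refl refl)))
      where ring : ∀ a b c d k → a + b + (c + d + k) ≡ a + c + (b + d) + k
            ring = solve-∀
    left-bound : ∀ v → p v ≡ true → 0ℤ ≤ net (left K) v + len (left K)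
    left-bound v pv = ≤-by (0≤+ (0≤W (0≤len K) (λ w → 0≤δ w v) cs) (0≤+ (K-bound pv) (0≤len cs)))
      (cong₂ _+_ (net-left-inner K pv) (len-left K))
      (ring (net (left K) v) (len (left K)) (W (λ w → δ w v) cs (len K)) (net K v) (len K) (len cs))
      where ring : ∀ a b w k l c → a + b - 0ℤ ≡ w + (k + l + c) + (a + b - (w + k + (c + l)))
            ring = solve-∀
    net-x : net L x ≡ out-x vs K
    net-x = ≡.trans (net-spokes-hub h (left K) vs-p px) (cong₂ _-_ (net-left-x K)
      (≡.trans (W-cong (len (left K)) (All.universal δ-h-x vs)) (cong (W (λ v → ⟦ adj x v ⟧) vs) (len-left K))))
    net-y : net L y ≡ out-y vs K
    net-y = ≡.trans (net-spokes-hub h (left K) vs-p py) (cong₂ _-_ (net-left-y K)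
      (≡.trans (W-cong (len (left K)) (All.universal δ-h-y vs)) (cong (W (λ v → ⟦ not (adj x v) ⟧) vs) (len-left K))))
    hubs-distinct : ∀ {u v} → u ≡ x ⊎ u ≡ y → v ≡ x ⊎ v ≡ y → net L u ≡ net L v → u ≡ v
    hubs-distinct (inj₁ refl) (inj₁ refl) _  = refl
    hubs-distinct (inj₂ refl) (inj₂ refl) _  = refl
    hubs-distinct (inj₁ refl) (inj₂ refl) eq = contradiction (≡.trans (sym net-x) (≡.trans eq net-y)) apart
    hubs-distinct (inj₂ refl) (inj₁ refl) eq = contradiction (≡.trans (sym net-x) (≡.trans (sym eq) net-y)) apart

  hub-pair : ∀ {u v} → u ≡ x ⊎ u ≡ y → v ≡ x ⊎ v ≡ y → ⟦ adj u v ⟧ ≡ ⟦ adj x y ⟧ * σ u v (x , y)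
  hub-pair {u} {v} u∈ v∈ = ≡.trans (value u∈ v∈) (cong (⟦ adj x y ⟧ *_) (sym (σ-def u v x y)))
    where
    null : ∀ a b c → c ≡ 0ℤ → a * (b * c + b * c) ≡ 0ℤ
    null a b c c≡0 = ≡.trans (cong (λ c → a * (b * c + b * c)) c≡0) (ring a b)
      where ring : ∀ a b → a * (b * 0ℤ + b * 0ℤ) ≡ 0ℤ
            ring = solve-∀
    null′ : ∀ a b c → c ≡ 0ℤ → a * (c * b + c * b) ≡ 0ℤ
    null′ a b c c≡0 = ≡.trans (cong (λ c → a * (c * b + c * b)) c≡0) (ring a b)
      where ring : ∀ a b → a * (0ℤ * b + 0ℤ * b) ≡ 0ℤ
            ring = solve-∀
    unit : ∀ a {b c d} → b ≡ 1ℤ → c ≡ 1ℤ → d ≡ 0ℤ → ∀ e → a * (b * c + d * e) ≡ a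
    unit a {b} {c} {d} b≡ c≡ d≡ e = ≡.trans
      (cong₂ (λ z d → a * (z + d * e)) (cong₂ _*_ b≡ c≡) d≡) (ring a e)
      where ring : ∀ a e → a * (1ℤ + 0ℤ * e) ≡ a
            ring = solve-∀
    value : u ≡ x ⊎ u ≡ y → v ≡ x ⊎ v ≡ y → ⟦ adj u v ⟧ ≡ ⟦ adj x y ⟧ * (δ x u * δ y v + δ x v * δ y u)
    value (inj₁ refl) (inj₁ refl) = ≡.trans (cong ⟦_⟧ (Graph.irrefl G x)) (sym (null ⟦ adj x y ⟧ (δ x x) (δ y x) (δ-≢ (x≢y ∘ sym))))
    value (inj₂ refl) (inj₂ refl) = ≡.trans (cong ⟦_⟧ (Graph.irrefl G y)) (sym (null′ ⟦ adj x y ⟧ (δ y y) (δ x y) (δ-≢ x≢y)))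
    value (inj₁ refl) (inj₂ refl) = sym (unit ⟦ adj x y ⟧ (δ-≡ refl) (δ-≡ refl) (δ-≢ x≢y) (δ y x))
    value (inj₂ refl) (inj₁ refl) = ≡.trans (cong ⟦_⟧ (Graph.sym G y x)) (sym (≡.trans
      (cong (⟦ adj x y ⟧ *_) (ℤ.+-comm (δ x y * δ y x) (δ x x * δ y y)))
      (unit ⟦ adj x y ⟧ (δ-≡ refl) (δ-≡ refl) (δ-≢ x≢y) (δ y x))))

  ⟦adj⟧-split : ∀ u v → ⟦ adj x y ⟧ * σ u v (x , y) + tot (σ u v) arcs ≡ ⟦ same-side u v ⟧
  ⟦adj⟧-split u v = ≡.trans (cong (⟦ adj x y ⟧ * σ u v (x , y) +_) (edges u v)) (split (p u) (p v) refl refl)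
    where
    σ-inner : p u ≡ true ⊎ p v ≡ true → ⟦ adj x y ⟧ * σ u v (x , y) ≡ 0ℤ
    σ-inner inner = ≡.trans (cong (⟦ adj x y ⟧ *_) (≡.trans (σ-def u v x y) (vanish inner))) (ℤ.*-zeroʳ ⟦ adj x y ⟧)
      where
      ring₁ : ∀ a b → 0ℤ * a + b * 0ℤ ≡ 0ℤ
      ring₁ = solve-∀
      ring₂ : ∀ a b → a * 0ℤ + 0ℤ * b ≡ 0ℤ
      ring₂ = solve-∀
      vanish : p u ≡ true ⊎ p v ≡ true → δ x u * δ y v + δ x v * δ y u ≡ 0ℤ
      vanish (inj₁ pu) = ≡.trans (cong₂ (λ a b → a * δ y v + δ x v * b) (δ-≢ (≢hub px pu)) (δ-≢ (≢hub py pu))) (ring₁ (δ y v) (δ x v))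
      vanish (inj₂ pv) = ≡.trans (cong₂ (λ a b → δ x u * a + b * δ y u) (δ-≢ (≢hub py pv)) (δ-≢ (≢hub px pv))) (ring₂ (δ x u) (δ y u))
    split : ∀ bu bv → p u ≡ bu → p v ≡ bv →
      ⟦ adj x y ⟧ * σ u v (x , y) + ⟦ bu ∧ bv ∧ adj u v ⟧ ≡ ⟦ not (bu xor bv) ∧ adj u v ⟧
    split true  true  pu pv = ≡.trans (cong (_+ ⟦ adj u v ⟧) (σ-inner (inj₁ pu))) (ℤ.+-identityˡ _)
    split true  false pu pv = cong (_+ 0ℤ) (σ-inner (inj₁ pu))
    split false true  pu pv = cong (_+ 0ℤ) (σ-inner (inj₂ pv))
    split false false pu pv = ≡.trans (ℤ.+-identityʳ _) (sym (hub-pair (hubs pu) (hubs pv)))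

  private
    0≤m : ∀ (K : List (Arc n)) → 0ℤ ≤ len cs + len K
    0≤m K = 0≤+ (0≤len cs) (0≤len K)

  configuration-apart : ∀ {vs} → adj x y ≡ false → Enumerates vs p → DistinctSums (net (left arcs)) vs →
    out-x vs arcs ≢ out-y vs arcs → AdmitsAntimagicOrientation G
  configuration-apart {vs} x≁y vs-p distinct =
    configuration arcs arcs-edges (λ {v} _ → bound v) vs-p distinct x≤0 y≤0
    where
    arcs-edges : ∀ u v → tot (σ u v) arcs ≡ ⟦ same-side u v ⟧
    arcs-edges u v = ≡.trans (sym (≡.trans
      (cong (_+ tot (σ u v) arcs) (≡.trans (cong (λ b → ⟦ b ⟧ * σ u v (x , y)) x≁y) (ℤ.*-zeroˡ (σ u v (x , y)))))
      (ℤ.+-identityˡ (tot (σ u v) arcs)))) (⟦adj⟧-split u v)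
    a a′ w : ℤ
    a  = W (λ v → ⟦ adj x v ⟧) vs (len cs + len arcs)
    a′ = W (λ v → ⟦ not (adj x v) ⟧) vs (len cs + len arcs)
    w  = W (λ _ → 1ℤ) cs (len arcs)
    x≤0 : out-x vs arcs ≤ 0ℤ
    x≤0 = ≤-by (0≤W (0≤m arcs) (λ v → 0≤⟦⟧ (adj x v)) vs) (sym (net-outside O px)) (ring (net arcs x) a)
      where ring : ∀ n a → 0ℤ - (n - a) ≡ a + (0ℤ - n)
            ring = solve-∀
    y≤0 : out-y vs arcs ≤ 0ℤ
    y≤0 = ≤-by (0≤+ (0≤W (0≤m arcs) (λ v → 0≤⟦⟧ (not (adj x v))) vs) (0≤W (0≤len arcs) (λ _ → 0≤1) cs))
      (sym (net-outside O py)) (ring (net arcs y) a′ w)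
      where ring : ∀ n a w → 0ℤ - (n - w - a) ≡ a + w + (0ℤ - n)
            ring = solve-∀

  -- For adjacent hubs, both directions of the arc between them are tried.
  adjacent-hubs : adj x y ≡ true → ∀ {zx zy} → p zx ≡ true → adj x zx ≡ true → p zy ≡ true → adj y zy ≡ true →
    AdmitsAntimagicOrientation G
  adjacent-hubs xy {zx} {zy} pzx x∼zx pzy y∼zy = [ second , first ]′ (toSum (out-x vs K₊ ℤ.≟ out-y vs K₊))
    where
    K₊ K₋ : List (Arc n)
    K₊ = (x , y) ∷ arcs
    K₋ = (y , x) ∷ arcs
    -- The label of the arc between the hubs: above all inner edges and below all spokes, so a
    -- single spoke at its head keeps that hub at or below 0.
    l : ℤ
    l = 1ℤ + len arcs
    1≤l : 1ℤ ≤ l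
    1≤l = ℤ.i≤i+j 1ℤ (len arcs) {{nonNegative (0≤len arcs)}}
    0≤l : 0ℤ ≤ l
    0≤l = ℤ.≤-trans 0≤1 1≤l
    enum : ∃[ vs ] Enumerates vs p × Sorted (net (left K₊)) vs
    enum = sorted-enum (net (left K₊)) p
    vs : List (Fin n)
    vs = proj₁ enum
    vs-p : Enumerates vs p
    vs-p = proj₁ (proj₂ enum)
    m a a′ w : ℤ
    m  = len cs + l
    a  = W (λ v → ⟦ adj x v ⟧) vs m
    a′ = W (λ v → ⟦ not (adj x v) ⟧) vs m
    w  = W (λ _ → 1ℤ) cs l
    edges₊ : ∀ u v → tot (σ u v) K₊ ≡ ⟦ same-side u v ⟧
    edges₊ u v = ≡.trans (cong (_+ tot (σ u v) arcs) (sym (≡.trans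
      (cong (λ b → ⟦ b ⟧ * σ u v (x , y)) xy) (ℤ.*-identityˡ (σ u v (x , y)))))) (⟦adj⟧-split u v)
    edges₋ : ∀ u v → tot (σ u v) K₋ ≡ ⟦ same-side u v ⟧
    edges₋ u v = ≡.trans (cong (_+ tot (σ u v) arcs) (σ-flip u v y x)) (edges₊ u v)
    net-arc : ∀ a b v {i j k} → δ a v ≡ i → δ b v ≡ j → net arcs v ≡ k → net ((a , b) ∷ arcs) v ≡ (j - i) * l + k
    net-arc a b v refl refl refl = refl
    ring₀ : ∀ l k → (0ℤ - 0ℤ) * l + k ≡ k
    ring₀ = solve-∀
    ring₊ : ∀ l → (1ℤ - 0ℤ) * l + 0ℤ ≡ l
    ring₊ = solve-∀
    ring₋ : ∀ l → (0ℤ - 1ℤ) * l + 0ℤ ≡ - l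
    ring₋ = solve-∀
    inner₊ : ∀ {v} → p v ≡ true → net K₊ v ≡ net arcs v
    inner₊ {v} pv = ≡.trans (net-arc x y v (δ-≢ (≢hub px pv)) (δ-≢ (≢hub py pv)) refl) (ring₀ l (net arcs v))
    inner₋ : ∀ {v} → p v ≡ true → net K₋ v ≡ net arcs v
    inner₋ {v} pv = ≡.trans (net-arc y x v (δ-≢ (≢hub py pv)) (δ-≢ (≢hub px pv)) refl) (ring₀ l (net arcs v))
    arcs-bound : ∀ v → 0ℤ ≤ net arcs v + l
    arcs-bound v = ≤-from _ (0≤+ 0≤1 (bound v)) (ring (net arcs v) (len arcs))
      where ring : ∀ a b → a + (1ℤ + b) - 0ℤ ≡ 1ℤ + (a + b)
            ring = solve-∀
    bound₊ : ∀ {v} → p v ≡ true → 0ℤ ≤ net K₊ v + len K₊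
    bound₊ {v} pv = subst (λ k → 0ℤ ≤ k + l) (sym (inner₊ pv)) (arcs-bound v)
    bound₋ : ∀ {v} → p v ≡ true → 0ℤ ≤ net K₋ v + len K₋
    bound₋ {v} pv = subst (λ k → 0ℤ ≤ k + l) (sym (inner₋ pv)) (arcs-bound v)
    distinct₊ : DistinctSums (net (left K₊)) vs
    distinct₊ = sorted⇒distinct (proj₂ (proj₂ enum))
    distinct₋ : DistinctSums (net (left K₋)) vs
    distinct₋ = DistinctSums-cong {f = net (left K₊)} (λ {v} v∈vs →
      ≡.trans (net-left-inner K₊ (∈-enum⁻ vs-p v∈vs))
      (≡.trans (cong (W (λ w → δ w v) cs l +_) (≡.trans (inner₊ (∈-enum⁻ vs-p v∈vs)) (sym (inner₋ (∈-enum⁻ vs-p v∈vs)))))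
      (sym (net-left-inner K₋ (∈-enum⁻ vs-p v∈vs))))) distinct₊
    x₊ : out-x vs K₊ ≡ - l - a
    x₊ = cong (_- a) (≡.trans (net-arc x y x (δ-≡ refl) (δ-≢ (x≢y ∘ sym)) (net-outside O px)) (ring₋ l))
    y₊ : out-y vs K₊ ≡ l - w - a′
    y₊ = cong (λ z → z - w - a′) (≡.trans (net-arc x y y (δ-≢ x≢y) (δ-≡ refl) (net-outside O py)) (ring₊ l))
    x₋ : out-x vs K₋ ≡ l - a
    x₋ = cong (_- a) (≡.trans (net-arc y x x (δ-≢ (x≢y ∘ sym)) (δ-≡ refl) (net-outside O px)) (ring₊ l))
    y₋ : out-y vs K₋ ≡ - l - w - a′
    y₋ = cong (λ z → z - w - a′) (≡.trans (net-arc y x y (δ-≡ refl) (δ-≢ x≢y) (net-outside O py)) (ring₋ l))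
    0≤w : 0ℤ ≤ w
    0≤w = 0≤W 0≤l (λ _ → 0≤1) cs
    0≤a′ : 0ℤ ≤ a′
    0≤a′ = 0≤W (0≤m K₊) (λ v → 0≤⟦⟧ (not (adj x v))) vs
    1+m≤a : 1ℤ + m ≤ a
    1+m≤a = 1+m≤W (0≤m K₊) (λ v → 0≤⟦⟧ (adj x v)) vs (1≤tot (adj x) (∈-enum⁺ vs-p pzx) x∼zx)
    l≤a : l ≤ a
    l≤a = ≤-from _ (0≤+ (0≤- 1+m≤a) (0≤+ 0≤1 (0≤len cs))) (ring a l (len cs))
      where ring : ∀ a l c → a - l ≡ a - (1ℤ + (c + l)) + (1ℤ + c)
            ring = solve-∀
    l≤w+a′ : l ≤ w + a′
    -- If `zy` is also a neighbour of x, its spoke from y is a small one and is counted in `w`;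
    -- otherwise it is a large one, counted in `a′`.
    l≤w+a′ with adj x zy in x∼zy
    ... | false = ≤-from _ (0≤+ (0≤+ 0≤w (0≤- 1+m≤a′)) (0≤+ 0≤1 (0≤len cs))) (ring w a′ l (len cs))
      where
      1+m≤a′ : 1ℤ + m ≤ a′
      1+m≤a′ = 1+m≤W (0≤m K₊) (λ v → 0≤⟦⟧ (not (adj x v))) vs
        (1≤tot (λ v → not (adj x v)) (∈-enum⁺ vs-p pzy) (cong not x∼zy))
      ring : ∀ w a l c → w + a - l ≡ w + (a - (1ℤ + (c + l))) + (1ℤ + c)
      ring = solve-∀
    ... | true  = ≤-from _ (0≤+ (0≤+ (0≤- 1+l≤w) 0≤a′) 0≤1) (ring w a′ l)
      where
      1+l≤w : 1ℤ + l ≤ w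
      1+l≤w = 1+m≤W 0≤l (λ _ → 0≤1) cs (≤tot {φ = λ _ → 1ℤ} (λ _ → 0≤1) (∈-enum⁺ cs-common
        (≡.trans (common-def zy) (cong₂ _∧_ pzy (cong₂ _∧_ x∼zy y∼zy)))))
      ring : ∀ w a l → w + a - l ≡ w - (1ℤ + l) + a + 1ℤ
      ring = solve-∀
    first : out-x vs K₊ ≢ out-y vs K₊ → AdmitsAntimagicOrientation G
    first = configuration K₊ edges₊ bound₊ vs-p distinct₊
      (≤-by (0≤+ 0≤l (ℤ.≤-trans 0≤l l≤a)) (sym x₊) (ring₁ (out-x vs K₊) l a))
      (≤-by (0≤- l≤w+a′) (sym y₊) (ring₂ (out-y vs K₊) l w a′))
      where
      ring₁ : ∀ o l a → 0ℤ - o ≡ l + a + (- l - a - o)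
      ring₁ = solve-∀
      ring₂ : ∀ o l w a → 0ℤ - o ≡ w + a - l + (l - w - a - o)
      ring₂ = solve-∀
    second : out-x vs K₊ ≡ out-y vs K₊ → AdmitsAntimagicOrientation G
    second tie = configuration K₋ edges₋ bound₋ vs-p distinct₋
      (≤-by (0≤- l≤a) (sym x₋) (ring₁ (out-x vs K₋) l a))
      (≤-by (0≤+ 0≤l (0≤+ 0≤w 0≤a′)) (sym y₋) (ring₂ (out-y vs K₋) l w a′))
      -- Reversing the arc changes s(x) - s(y) by 4l, and l ≥ 1, so the two labelings cannot both
      -- tie.
      (λ tie′ → ⊥-by (0≤+ (0≤- 1≤l) (0≤+ 0≤l (0≤+ 0≤l 0≤l)))
        (cong₂ _+_ (≡.trans (sym x₊) (≡.trans tie y₊)) (≡.trans (sym y₋) (≡.trans (sym tie′) x₋)))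
        (ring₃ l a a′ w))
      where
      ring₁ : ∀ o l a → 0ℤ - o ≡ a - l + (l - a - o)
      ring₁ = solve-∀
      ring₂ : ∀ o l w a → 0ℤ - o ≡ l + (w + a) + (- l - w - a - o)
      ring₂ = solve-∀
      ring₃ : ∀ l a b w → - 1ℤ ≡ l - 1ℤ + (l + (l + l)) + (- l - a + (- l - w - b) - (l - w - b + (l - a)))
      ring₃ = solve-∀

-- Breaking ties between nonadjacent hubs

-- Gauss's sum 1 + ... + l, doubled to avoid division.
wt-1 : (as : List X) → wt (λ _ → 1ℤ) as + wt (λ _ → 1ℤ) as ≡ len as * (1ℤ + len as)
wt-1 []       = refl
wt-1 (a ∷ as) = ≡-by (wt-1 as) (ring (len as) (wt (λ _ → 1ℤ) as))
  where ring : ∀ l w → 1ℤ * (1ℤ + l) + w + (1ℤ * (1ℤ + l) + w) - (1ℤ + l) * (1ℤ + (1ℤ + l)) ≡ w + w - l * (1ℤ + l)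
        ring = solve-∀

wt-1≤ : (as : List X) → wt (λ _ → 1ℤ) as ≤ len as * len as
wt-1≤ []       = ℤ.≤-refl
wt-1≤ (a ∷ as) = ≤-from _ (0≤+ (0≤- (wt-1≤ as)) (0≤len as)) (ring (len as) (wt (λ _ → 1ℤ) as))
  where ring : ∀ l w → (1ℤ + l) * (1ℤ + l) - (1ℤ * (1ℤ + l) + w) ≡ l * l - w + l
        ring = solve-∀

wt-1-↭ : ∀ {as bs : List X} → as ↭ bs → wt (λ _ → 1ℤ) as ≡ wt (λ _ → 1ℤ) bs
wt-1-↭ {as = as} {bs} as↭bs = halve (≡.trans (wt-1 as)
  (≡.trans (cong (λ l → l * (1ℤ + l)) (tot-↭ (λ _ → 1ℤ) as↭bs)) (sym (wt-1 bs))))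

W-not : ∀ (cl : X → Bool) as m → W (λ v → ⟦ cl v ⟧) as m + W (λ v → ⟦ not (cl v) ⟧) as m ≡ W (λ _ → 1ℤ) as m
W-not cl as m = ≡.trans (sym (W-+ (λ v → ⟦ cl v ⟧) (λ v → ⟦ not (cl v) ⟧) as m))
  (W-cong m (All.universal (λ v → ⟦⟧+⟦not⟧ (cl v)) as))

module NonAdjacentHubs (G : Graph n) {p common : Fin n → Bool} (O : InnerOrder G p) {cs} (cs-common : Enumerates cs common)
  {x y : Fin n} (x≢y : x ≢ y) (px : p x ≡ false) (py : p y ≡ false)
  (hubs : ∀ {v} → p v ≡ false → v ≡ x ⊎ v ≡ y)
  (common-def : ∀ v → common v ≡ p v ∧ (Graph.adj G x v ∧ Graph.adj G y v))
  (dominated : ∀ {v} → p v ≡ true → Graph.adj G x v ≡ false → Graph.adj G y v ≡ true)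
  (x≁y : Graph.adj G x y ≡ false) where

  open Graph G using (adj)
  open InnerOrder O

  private
    undominated : ∀ {v} → p v ≡ true → adj y v ≡ false → adj x v ≡ true
    undominated {v} pv yv with adj x v in xv
    ... | true  = refl
    ... | false = contradiction (≡.trans (sym (dominated pv xv)) yv) true≢false

    module XY = TwoHubs G O cs-common x≢y px py hubs common-def dominated
    module YX = TwoHubs G O cs-common (x≢y ∘ sym) py px ([ inj₂ , inj₁ ]′ ∘ hubs)
      (λ v → ≡.trans (common-def v) (cong (p v ∧_) (Bool.∧-comm (adj x v) (adj y v)))) undominated

    m : ℤ
    m = len cs + len arcs

    -- The spokes have a fixed total label sum, so in a tie the large spokes at the first hub take
    -- exactly half of it.
    tie : ∀ (cl : Fin n → Bool) {nx ny w vs} → nx ≡ 0ℤ → ny ≡ 0ℤ → nx - W (λ v → ⟦ cl v ⟧) vs m ≡ ny - w - W (λ v → ⟦ not (cl v) ⟧) vs m →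
      W (λ v → ⟦ cl v ⟧) vs m + W (λ v → ⟦ cl v ⟧) vs m ≡ w + W (λ _ → 1ℤ) vs m
    tie cl {nx} {ny} {w} {vs} nx≡0 ny≡0 eq = ≡-by
      (cong₂ _+_ (cong₂ _+_ (sym eq) nx≡0) (cong₂ _+_ (sym ny≡0) (W-not cl vs m)))
      (ring nx ny w (W (λ v → ⟦ cl v ⟧) vs m) (W (λ v → ⟦ not (cl v) ⟧) vs m) (W (λ _ → 1ℤ) vs m))
      where ring : ∀ nx ny w a b t → a + a - (w + t) ≡ ny - w - b + nx + (0ℤ + (a + b)) - (nx - a + 0ℤ + (ny + t))
            ring = solve-∀

  -- Two orders of the inner vertices in which the edges at x receive different totals.
  without-common : cs ≡ [] → ∀ {zx zy} → p zx ≡ true → adj x zx ≡ true → p zy ≡ true → adj y zy ≡ true →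
    AdmitsAntimagicOrientation G
  without-common refl {zx} {zy} pzx x∼zx pzy y∼zy = choose (XY.out-x vs arcs ℤ.≟ XY.out-y vs arcs)
    where
    enum : ∃[ vs ] Enumerates vs p × Sorted (net arcs) vs
    enum = sorted-enum (net arcs) p
    vs : List (Fin n)
    vs = proj₁ enum
    vs-p : Enumerates vs p
    vs-p = proj₁ (proj₂ enum)
    x≁zy : adj x zy ≢ true
    x≁zy x∼zy with ∈-enum⁺ cs-common (≡.trans (common-def zy) (cong₂ _∧_ pzy (cong₂ _∧_ x∼zy y∼zy)))
    ... | ()
    other : Reordering (net arcs) (adj x) vs
    other = reorder (net arcs) (adj x) (proj₂ (proj₂ enum)) (net-zero-sum O vs-p)
      (∈-enum⁺ vs-p pzx) (∈-enum⁺ vs-p pzy) (λ e → x≁zy (≡.trans (sym e) x∼zx))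
    vs′ : List (Fin n)
    vs′ = proj₁ other
    vs′↭vs : vs′ ↭ vs
    vs′↭vs = proj₁ (proj₂ other)
    a a′ : ℤ
    a  = W (λ v → ⟦ adj x v ⟧) vs m
    a′ = W (λ v → ⟦ adj x v ⟧) vs′ m
    totals : W (λ _ → 1ℤ) vs′ m ≡ W (λ _ → 1ℤ) vs m
    totals = ≡.trans (W-def (λ _ → 1ℤ) vs′ m)
      (≡.trans (cong₂ (λ s t → s + m * t) (wt-1-↭ vs′↭vs) (tot-↭ (λ _ → 1ℤ) vs′↭vs)) (sym (W-def (λ _ → 1ℤ) vs m)))
    a′≢a : a′ ≢ a
    a′≢a eq = proj₂ (proj₂ (proj₂ other)) (≡-by
      (cong₂ _+_ (≡.trans (sym (W-def (λ v → ⟦ adj x v ⟧) vs′ m)) (≡.trans eq (W-def (λ v → ⟦ adj x v ⟧) vs m)))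
        (cong (m *_) (sym (tot-↭ (λ v → ⟦ adj x v ⟧) vs′↭vs))))
      (ring (wt (λ v → ⟦ adj x v ⟧) vs′) (wt (λ v → ⟦ adj x v ⟧) vs) (m * tot (λ v → ⟦ adj x v ⟧) vs′) (m * tot (λ v → ⟦ adj x v ⟧) vs)))
      where ring : ∀ s t q r → s - t ≡ s + q + r - (t + r + q)
            ring = solve-∀
    choose : Dec (XY.out-x vs arcs ≡ XY.out-y vs arcs) → AdmitsAntimagicOrientation G
    choose (no apart) = XY.configuration-apart x≁y vs-p (sorted⇒distinct (proj₂ (proj₂ enum))) apart
    -- Both orders use the same set of labels, so two ties would give x the same half, against
    -- `a′≢a`.
    choose (yes eq) = XY.configuration-apart x≁y (↭-trans vs′↭vs vs-p) (proj₁ (proj₂ (proj₂ other))) λ eq′ →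
      a′≢a (halve (≡.trans (tie (adj x) {vs = vs′} (net-outside O px) (net-outside O py) eq′)
        (≡.trans (cong (W (λ _ → 1ℤ) [] (len arcs) +_) totals)
          (sym (tie (adj x) {vs = vs} (net-outside O px) (net-outside O py) eq)))))

  -- Exchanging the roles of x and y moves the larger labels of the common neighbours from x to y.
  with-common : 1ℤ ≤ len cs → AdmitsAntimagicOrientation G
  with-common 1≤c = choose (XY.out-x vs arcs ℤ.≟ XY.out-y vs arcs)
    where
    enum : ∃[ vs ] Enumerates vs p × Sorted (net (XY.left arcs)) vs
    enum = sorted-enum (net (XY.left arcs)) p
    vs : List (Fin n)
    vs = proj₁ enum
    vs-p : Enumerates vs p
    vs-p = proj₁ (proj₂ enum)
    distinct : DistinctSums (net (XY.left arcs)) vs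
    distinct = sorted⇒distinct (proj₂ (proj₂ enum))
    -- A small spoke enters its tip with the same label from either hub, so the partial sums and
    -- hence the order `vs` can be kept.
    distinct′ : DistinctSums (net (YX.left arcs)) vs
    distinct′ = DistinctSums-cong {f = net (XY.left arcs)} (λ v∈vs → ≡.trans
      (XY.net-left-inner arcs (∈-enum⁻ vs-p v∈vs)) (sym (YX.net-left-inner arcs (∈-enum⁻ vs-p v∈vs)))) distinct
    a b b′ k w t : ℤ
    a  = W (λ v → ⟦ adj x v ⟧) vs m
    b  = W (λ v → ⟦ adj y v ⟧) vs m
    b′ = W (λ v → ⟦ not (adj y v) ⟧) vs m
    k  = W (λ v → ⟦ common v ⟧) vs m
    w  = W (λ _ → 1ℤ) cs (len arcs)
    t  = W (λ _ → 1ℤ) vs m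
    a≡b′+k : a ≡ b′ + k
    a≡b′+k = ≡.trans (W-cong m (All.tabulate (λ v∈vs → sym (YX.adj-y-split (∈-enum⁻ vs-p v∈vs)))))
      (W-+ (λ v → ⟦ not (adj y v) ⟧) (λ v → ⟦ common v ⟧) vs m)
    tot-common : tot (λ v → ⟦ common v ⟧) vs ≡ len cs
    tot-common = ≡.trans (tot-enum vs-p (λ v → ⟦ common v ⟧))
      (≡.trans (tot-ext (λ v → inner v (p v) refl) (allFin n)) (sym (tot-enum cs-common (λ _ → 1ℤ))))
      where
      inner : ∀ v b → p v ≡ b → ⟦ p v ⟧ * ⟦ common v ⟧ ≡ ⟦ common v ⟧ * 1ℤ
      inner v true  pv = ≡.trans (cong (λ b → ⟦ b ⟧ * ⟦ common v ⟧) pv) (ℤ.*-comm 1ℤ ⟦ common v ⟧)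
      inner v false pv = ≡.trans (cong₂ (λ b c → ⟦ b ⟧ * ⟦ c ⟧) pv (XY.not-common pv))
        (sym (cong (λ c → ⟦ c ⟧ * 1ℤ) (XY.not-common pv)))
    -- With c common neighbours and l inner arcs, the large labels exceed c + l, so k ≥ c + (c +
    -- l)c, whereas w ≤ c² + lc; and c ≥ 1.
    1+w≤k : 1ℤ + w ≤ k
    1+w≤k = ≤-by
      (0≤+ (0≤- (tot≤wt (λ v → 0≤⟦⟧ (common v)) vs)) (0≤+ (0≤- 1≤c) (0≤- (wt-1≤ cs))))
      (cong₂ _+_ (cong₂ _+_ (W-def (λ v → ⟦ common v ⟧) vs m) tot-common)
        (cong₂ _+_ (sym (W-def (λ _ → 1ℤ) cs (len arcs))) (cong (m *_) tot-common)))
      (ring k w (wt (λ v → ⟦ common v ⟧) vs) (tot (λ v → ⟦ common v ⟧) vs) (len cs) (len arcs) (wt (λ _ → 1ℤ) cs)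
        (m * tot (λ v → ⟦ common v ⟧) vs))
      where
      ring : ∀ k w g t c l e q → k - (1ℤ + w) ≡
        g - t + (c - 1ℤ + (c * c - e)) + (k + t + (e + l * c + q) - (g + q + c + (w + (c + l) * c)))
      ring = solve-∀
    choose : Dec (XY.out-x vs arcs ≡ XY.out-y vs arcs) → AdmitsAntimagicOrientation G
    choose (no apart) = XY.configuration-apart x≁y vs-p distinct apart
    choose (yes eq) = YX.configuration-apart (≡.trans (Graph.sym G y x) x≁y) vs-p distinct′ λ eq′ →
      -- The ties read 2a = w + t and 2b = w + t. Common neighbours are counted at both hubs, so a +
      -- b = t + k; together these give k = w, against `1+w≤k`.
      ⊥-by (0≤+ (0≤+ (0≤- 1+w≤k) (0≤- 1+w≤k)) 0≤1)
        (cong₂ _+_ (cong₂ _+_ (sym (tie (adj x) {vs = vs} (net-outside O px) (net-outside O py) eq))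
                     (sym (tie (adj y) {vs = vs} (net-outside O py) (net-outside O px) eq′)))
          (cong₂ _+_ (cong₂ _+_ a≡b′+k a≡b′+k) (cong₂ _+_ (W-not (adj y) vs m) (W-not (adj y) vs m))))
        (ring a b b′ k w t)
      where ring : ∀ a b b′ k w t → - 1ℤ ≡ k - (1ℤ + w) + (k - (1ℤ + w)) + 1ℤ +
              (w + t + (w + t) + (a + a + (b + b′ + (b + b′))) - (a + a + (b + b) + (b′ + k + (b′ + k) + (t + t))))
            ring = solve-∀

-- From the neighbourhood hypotheses to the choice of hubs

∈N⁻ : ∀ (G : Graph n) {u v} → v ∈ₛ N G u → Graph.adj G u v ≡ true
∈N⁻ G {u} {v} v∈N = ≡.trans (sym (lookup∘tabulate (Graph.adj G u) v)) ([]=⇒lookup v∈N)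

∈closedN⁻ : ∀ (G : Graph n) {u v} → v ∈ₛ closedN G u → Graph.adj G u v ≡ true ⊎ v ≡ u
∈closedN⁻ G {u} v∈ with x∈p∪q⁻ (N G u) ⁅ u ⁆ v∈
... | inj₁ v∈N = inj₁ (∈N⁻ G v∈N)
... | inj₂ v∈u = inj₂ (x∈⁅y⁆⇒x≡y u v∈u)

degree≢0⇒neighbour : ∀ (G : Graph n) {x} → d G x ≢ 0 → ∃[ z ] Graph.adj G x z ≡ true
degree≢0⇒neighbour {n} G {x} d≢0
  with z , _ , nz ← tot≢0⇒∃ (allFin n) (λ t≡0 → d≢0 (ℤ.+-injective (≡.trans (tot-∣∣ (Graph.adj G x)) t≡0))) = z , is-true nz
  where
  is-true : ∀ {b} → ⟦ b ⟧ ≢ 0ℤ → b ≡ true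
  is-true {true}  _  = refl
  is-true {false} nz = contradiction refl nz

Dominating : Graph n → Fin n → Fin n → Set
Dominating G x y = ∀ v → v ≢ x → v ≢ y → Graph.adj G x v ≡ true ⊎ Graph.adj G y v ≡ true

closedN-cover : ∀ (G : Graph n) x y → closedN G x ∪ closedN G y ≡ ⊤ → Dominating G x y
closedN-cover G x y cover v v≢x v≢y with x∈p∪q⁻ (closedN G x) (closedN G y) (subst (v ∈ₛ_) (sym cover) ∈⊤)
... | inj₁ v∈x = [ inj₁ , (λ v≡x → contradiction v≡x v≢x) ]′ (∈closedN⁻ G v∈x)
... | inj₂ v∈y = [ inj₂ , (λ v≡y → contradiction v≡y v≢y) ]′ (∈closedN⁻ G v∈y)

module _ (G : Graph n) where
  open Graph G using (adj)

  OtherNeighbour : Fin n → Fin n → Set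
  OtherNeighbour y x = ∃[ v ] adj y v ≡ true × v ≢ x

  other-neighbour? : ∀ y x → Dec (OtherNeighbour y x)
  other-neighbour? y x = Fin.any? (λ v → (adj y v Bool.≟ true) ×-dec ¬? (v ≟ x))

  -- By domination, a non-neighbour of x other than x itself could only be y; in that case y, having
  -- no neighbour but possibly x, is isolated.
  one-sided : ∀ {x y} → Dominating G x y → ¬ OtherNeighbour y x → (∃[ z ] adj x z ≡ true) →
    AdmitsAntimagicOrientation G
  one-sided {x} {y} dom none has-neighbour = one-hub G x has-neighbour
    (λ u≢x v≢x xu xv → ≡.trans (is-y u≢x xu) (sym (is-y v≢x xv)))
    (λ u≢x xu → subst (λ u → ∀ v → adj u v ≡ false) (sym (is-y u≢x xu)) (isolated (subst (λ u → adj x u ≡ false) (is-y u≢x xu) xu)))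
    where
    is-y : ∀ {u} → u ≢ x → adj x u ≡ false → u ≡ y
    is-y {u} u≢x xu with u ≟ y
    ... | yes u≡y = u≡y
    ... | no  u≢y = [ (λ xu′ → contradiction (≡.trans (sym xu′) xu) true≢false) , (λ yu → contradiction (u , yu , u≢x) none) ]′
      (dom u u≢x u≢y)
    isolated : adj x y ≡ false → ∀ v → adj y v ≡ false
    isolated xy v with v ≟ x
    ... | yes refl = ≡.trans (Graph.sym G y x) xy
    ... | no v≢x   = Bool.¬-not (λ yv → none (v , yv , v≢x))

  two-sided : ∀ {x y} → x ≢ y → Dominating G x y → OtherNeighbour x y → OtherNeighbour y x →
    AdmitsAntimagicOrientation G
  two-sided {x} {y} x≢y dom (zx , x∼zx , zx≢y) (zy , y∼zy , zy≢x) = by-edge (adj x y Bool.≟ true)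
    where
    p common : Fin n → Bool
    p v = not (does (v ≟ x)) ∧ not (does (v ≟ y))
    common v = p v ∧ (adj x v ∧ adj y v)
    O : InnerOrder G p
    O = inner-order G p
    cs : List (Fin n)
    cs = filterᵇ common (allFin n)
    px : p x ≡ false
    px = cong (λ b → not b ∧ not (does (x ≟ y))) (dec-true (x ≟ x) refl)
    py : p y ≡ false
    py = ≡.trans (cong (λ b → not (does (y ≟ x)) ∧ not b) (dec-true (y ≟ y) refl)) (Bool.∧-zeroʳ _)
    inner : ∀ {v} → v ≢ x → v ≢ y → p v ≡ true
    inner {v} v≢x v≢y = cong₂ (λ a b → not a ∧ not b) (dec-false (v ≟ x) v≢x) (dec-false (v ≟ y) v≢y)
    hubs : ∀ {v} → p v ≡ false → v ≡ x ⊎ v ≡ y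
    hubs {v} pv with v ≟ x | v ≟ y
    ... | yes v≡x | _       = inj₁ v≡x
    ... | no _    | yes v≡y = inj₂ v≡y
    ... | no v≢x  | no v≢y  = contradiction pv true≢false
    ≢self : ∀ {u v} → adj u v ≡ true → v ≢ u
    ≢self {u} uv refl = true≢false (≡.trans (sym uv) (Graph.irrefl G u))
    dominated : ∀ {v} → p v ≡ true → adj x v ≡ false → adj y v ≡ true
    dominated {v} pv xv = [ (λ xv′ → contradiction (≡.trans (sym xv′) xv) true≢false) , (λ yv → yv) ]′
      (dom v (λ { refl → true≢false (≡.trans (sym pv) px) }) (λ { refl → true≢false (≡.trans (sym pv) py) }))
    pzx : p zx ≡ true
    pzx = inner (≢self x∼zx) zx≢y
    pzy : p zy ≡ true
    pzy = inner zy≢x (≢self y∼zy)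
    empty? : (as : List (Fin n)) → as ≡ [] ⊎ 1ℤ ≤ len as
    empty? []       = inj₁ refl
    empty? (_ ∷ as) = inj₂ (ℤ.i≤i+j 1ℤ (len as) {{nonNegative (0≤len as)}})
    by-edge : Dec (adj x y ≡ true) → AdmitsAntimagicOrientation G
    by-edge (yes xy) = TwoHubs.adjacent-hubs G O ↭-refl x≢y px py hubs (λ _ → refl) dominated xy pzx x∼zx pzy y∼zy
    by-edge (no ¬xy) = [ (λ e → without-common e pzx x∼zx pzy y∼zy) , with-common ]′ (empty? cs)
      where open NonAdjacentHubs G O ↭-refl x≢y px py hubs (λ _ → refl) dominated (Bool.¬-not ¬xy)

theorem2p3 : (n : ℕ) (G : Graph n) (x y : Fin n) →
    x ≢ y →
    closedN G x ∪ closedN G y ≡ ⊤ →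
    d G x ≥ d G y →
    (d G x ≥ 4) ⊎ Nonempty (N G x ∩ closedN G y) →
    AdmitsAntimagicOrientation G
theorem2p3 n G x y x≢y cover _ d≥4⊎overlap
  with other-neighbour? G y x | other-neighbour? G x y
... | no  none | _ = one-sided G (closedN-cover G x y cover) none (neighbour d≥4⊎overlap)
  where
  -- Either alternative supplies an edge at x, which keeps s(x) negative and so apart from a
  -- possible isolated y.
  neighbour : (d G x ≥ 4) ⊎ Nonempty (N G x ∩ closedN G y) → ∃[ z ] Graph.adj G x z ≡ true
  neighbour (inj₁ d≥4) = degree≢0⇒neighbour G (λ d≡0 → contradiction (subst (_≥ 4) d≡0 d≥4) λ ())
  neighbour (inj₂ (z , z∈)) = z , ∈N⁻ G (proj₁ (x∈p∩q⁻ (N G x) (closedN G y) z∈))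
... | yes (z , yz , _) | no none = one-sided G (λ v v≢y v≢x → Sum.swap (closedN-cover G x y cover v v≢x v≢y)) none (z , yz)
... | yes y-other | yes x-other = two-sided G x≢y (closedN-cover G x y cover) x-other y-other
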